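{- Let $G$ be a finite connected regularly diagonal directed graph, i.e. $\mathrm{EMH}_{k,\ell}(G)=0$ for all $k\neq\ell$. Then the regular path homology groups of $G$ are isomorphic to the homology groups of the complex of injective words on $G$: $H_k(\Omega^\iota_*(G),\partial)\cong H_k(\mathrm{Inj}(G);R)$ for all $k\geq 0$.
   Context: $R$ is a fixed commutative unital ring. A directed graph $G$ has vertex set $V(G)$ and edge set $E(G)\subseteq V(G)\times V(G)$; connected means connected as an undirected graph. $d_G(x,y)$ is the minimal length of a directed path from $x$ to $y$ ($\infty$ if there is none), and $\mathrm{len}(x_0,\dots,x_k)=\sum_{i=0}^{k-1}d_G(x_i,x_{i+1})$ when all terms are finite. Eulerian magnitude homology: $\mathrm{EMC}_{k,\ell}(G)$ is the free $R$-module on tuples $(x_0,\dots,x_k)$ of pairwise distinct vertices with $d_G(x_i,x_{i+1})<\infty$ for all $i$ and length $\ell$; $\partial=\sum_{i=1}^{k-1}(-1)^i\partial_i$, where $\partial_i$ deletes $x_i$ if the resulting tuple still has length $\ell$ and is $0$ otherwise; $\mathrm{EMH}_{k,\ell}(G)=H_k(\mathrm{EMC}_{*,\ell}(G),\partial)$. Regular path homology: let $\Lambda_n(G)$ be the free $R$-module on all $(n+1)$-tuples of vertices, with $\partial=\sum_{i=0}^n(-1)^i(\text{delete the } i\text{ -th entry})$ (and $\partial=0$ for $n=0$). A tuple $(x_0,\dots,x_n)$ is allowed if $(x_i,x_{i+1})\in E(G)$ for all $i$, and strongly regular if its entries are pairwise distinct. Let $\mathcal{A}^\iota_n(G)\subseteq\Lambda_n(G)$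 be spanned by the strongly regular allowed tuples, and $\Omega^\iota_n(G)=\{v\in\mathcal{A}^\iota_n(G)\mid \partial v\in\mathcal{A}^\iota_{n-1}(G)\}$ (with $\Omega^\iota_0=\mathcal{A}^\iota_0$). The regular path homology groups are the homology groups of $(\Omega^\iota_*(G),\partial)$. Complex of injective words: $\mathrm{Inj}(G)$ is the complex (ordered simplicial complex, i.e. semi-simplicial set) whose $p$-simplices are the words $x_0\cdots x_p$ of pairwise distinct vertices of $G$ such that for all $i<j$ there is a directed path in $G$ from $x_i$ to $x_j$, with faces given by deleting letters. -}

module Defs where

open import Algebra.Bundles using (CommutativeMonoid; CommutativeRing)
import Algebra.Properties.CommutativeMonoid.Sum as CommutativeMonoidSum
import Algebra.Properties.CommutativeSemigroup as CommutativeSemigroupProperties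
import Algebra.Properties.AbelianGroup as AbelianGroupProperties
import Algebra.Properties.Semiring.Exp as Exponentiation
open import Algebra.Module.Bundles using (LeftModule)
open import Algebra.Module.Morphism.Structures using (module LeftModuleMorphisms)
open import Data.Fin.Base using (Fin; zero; suc; toℕ; inject₁)
import Data.Fin.Properties as Fin
open import Data.Nat.Base using (ℕ; zero; suc; _+_; _∸_; _≤_; z≤n; s≤s)
import Data.Nat.Properties as ℕ
open import Data.Product.Base using (Σ; ∃; ∃-syntax; Σ-syntax; _×_; _,_; proj₁; proj₂; map₂)
open import Data.Unit.Polymorphic.Base using (⊤; tt)
open import Data.Vec.Base using (Vec; []; _∷_; removeAt)
open import Data.Vec.Relation.Unary.All using (All; []; _∷_)
open import Data.Vec.Relation.Unary.AllPairs using (AllPairs; []; _∷_)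
open import Data.Vec.Relation.Unary.Linked using (Linked)
open import Data.Vec.Relation.Unary.Unique.Propositional using (Unique)
open import Function.Base using (_∘_)
open import Function.Bundles using (Func; _↔_; module Inverse)
open import Function.Construct.Composition using () renaming (function to _⟶∘_)
open import Function.Properties.Inverse using (↔⇒↣)
open import Level using (Level; _⊔_; 0ℓ) renaming (suc to lsuc)
open import Relation.Binary.Bundles using (Setoid)
open import Relation.Binary.Core using (Rel)
open import Relation.Binary.Definitions using (Decidable)
import Relation.Binary.Construct.Closure.Equivalence as Equivalence
import Relation.Binary.Construct.On as On
open import Relation.Binary.PropositionalEquality using (_≡_; _≢_; refl; sym; trans; cong; subst; subst₂)
import Relation.Binary.PropositionalEquality.Properties as ≡
import Relation.Binary.Reasoning.Setoid as SetoidReasoning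
open import Relation.Nullary.Decidable using (Dec; yes; no; map′; _×-dec_; ¬?; via-injection)
open import Relation.Nullary.Negation using (¬_; contradiction)
open import Relation.Unary using (Pred)

record SemiSimplicialSet (a e : Level) : Set (lsuc (a ⊔ e)) where
  field
    Simplex : ℕ → Setoid a e
    face    : ∀ n → Fin (suc (suc n)) → Func (Simplex (suc n)) (Simplex n)
    -- The simplicial identity dᵢ dⱼ₊₁ = dⱼ dᵢ for i ≤ j.
    face-face : ∀ n (i j : Fin (suc (suc n))) → toℕ i ≤ toℕ j → ∀ x →
                Setoid._≈_ (Simplex n)
                  (Func.to (face n i) (Func.to (face (suc n) (suc j)) x))
                  (Func.to (face n j) (Func.to (face (suc n) (inject₁ i)) x))

module _ {a : Level} {A : Set a} where

  removeAt-suc : ∀ {n} x (ys : Vec A (suc n)) i → removeAt (x ∷ ys) (suc i) ≡ x ∷ removeAt ys i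
  removeAt-suc x (_ ∷ _) i = refl

  removeAt-removeAt : ∀ {n} (xs : Vec A (suc (suc n))) (i j : Fin (suc n)) → toℕ i ≤ toℕ j →
                      removeAt (removeAt xs (suc j)) i ≡ removeAt (removeAt xs (inject₁ i)) j
  removeAt-removeAt (x ∷ y ∷ xs)     zero    j       _         = refl
  removeAt-removeAt (x ∷ y ∷ z ∷ xs) (suc i) (suc j) (s≤s i≤j) =
    trans (removeAt-suc x (removeAt (y ∷ z ∷ xs) (suc j)) i)
      (trans (cong (x ∷_) (removeAt-removeAt (y ∷ z ∷ xs) i j i≤j))
        (sym (removeAt-suc x (removeAt (y ∷ z ∷ xs) (inject₁ i)) j)))

  All-removeAt : ∀ {p} {P : Pred A p} {n} {xs : Vec A (suc n)} i → All P xs → All P (removeAt xs i)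
  All-removeAt                   zero    (p ∷ ps)         = ps
  All-removeAt {xs = _ ∷ _ ∷ _} (suc i) (p ∷ ps@(_ ∷ _)) = p ∷ All-removeAt i ps

  AllPairs-removeAt : ∀ {r} {R : Rel A r} {n} {xs : Vec A (suc n)} i →
                      AllPairs R xs → AllPairs R (removeAt xs i)
  AllPairs-removeAt                   zero    (p ∷ ps)         = ps
  AllPairs-removeAt {xs = _ ∷ _ ∷ _} (suc i) (p ∷ ps@(_ ∷ _)) =
    All-removeAt i p ∷ AllPairs-removeAt i ps

  -- Tuples satisfying P, compared by their entries only.
  tuples : ∀ {p n} → Pred (Vec A n) p → Setoid (a ⊔ p) a
  tuples {n = n} P = On.setoid {B = Σ (Vec A n) P} (≡.setoid (Vec A n)) proj₁

-- Decidability of E makes distances and lengths decidable, which the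
-- case distinction in the boundary of the magnitude complex requires.
-- Loops are permitted.
record FiniteDigraph : Set₁ where
  field
    V      : Set
    E      : Rel V 0ℓ
    E?     : Decidable E
    size   : ℕ
    finite : V ↔ Fin size

module _ (G : FiniteDigraph) where
  open FiniteDigraph G

  Connected : Set
  Connected = ∀ x y → Equivalence.EqClosure E x y

  data Path : ℕ → V → V → Set where
    ε   : ∀ {x} → Path 0 x x
    _◅_ : ∀ {n x y z} → E x y → Path n y z → Path (suc n) x z

  Reachable : Rel V 0ℓ
  Reachable x y = ∃[ n ] Path n x y

  -- Distance x y m says that d(x , y) = m; it holds for no m precisely
  -- when d(x , y) = ∞.
  Distance : V → V → ℕ → Set
  Distance x y m = Path m x y × (∀ {k} → Path k x y → m ≤ k)

  -- Length (x₀ ∷ … ∷ xₖ) l says that all d(xᵢ , xᵢ₊₁) are finite, with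
  -- sum l.
  data Length : ∀ {k} → Vec V (suc k) → ℕ → Set where
    [-] : ∀ {x} → Length (x ∷ []) 0
    _∷_ : ∀ {x y m k l} {xs : Vec V k} →
          Distance x y m → Length (y ∷ xs) l → Length (x ∷ y ∷ xs) (m + l)

  StronglyRegular : ∀ {n} → Pred (Vec V n) 0ℓ
  StronglyRegular = Unique

  Allowed : ∀ {n} → Pred (Vec V n) 0ℓ
  Allowed = Linked E

  any? : {P : V → Set} → (∀ x → Dec (P x)) → Dec (∃ P)
  any? {P} P? = map′
    (λ (i , p) → from i , p)
    (λ (x , p) → to x , subst P (sym (strictlyInverseʳ x)) p)
    (Fin.any? (λ i → P? (from i)))
    where open Inverse finite

  Path? : ∀ n x y → Dec (Path n x y)
  Path? zero x y = map′ (λ { refl → ε }) (λ { ε → refl }) (via-injection (↔⇒↣ finite) Fin._≟_ x y)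
  Path? (suc n) x z = map′ (λ (y , e , p) → e ◅ p) (λ { (e ◅ p) → _ , e , p })
    (any? (λ y → E? x y ×-dec Path? n y z))

  Distance? : ∀ x y m → Dec (Distance x y m)
  Distance? x y m = map′
    (λ (p , shortest) → p , λ {k} q → ℕ.≮⇒≥ (λ k<m → shortest (k , k<m , q)))
    (λ (p , shortest) → p , λ (k , k<m , q) → ℕ.<⇒≱ k<m (shortest q))
    (Path? m x y ×-dec ¬? (ℕ.anyUpTo? (λ k → Path? k x y) m))

  Length? : ∀ {k} (xs : Vec V (suc k)) l → Dec (Length xs l)
  Length? (x ∷ [])     zero    = yes [-]
  Length? (x ∷ [])     (suc l) = no λ ()
  Length? (x ∷ y ∷ xs) l = map′
    (λ (m , m<1+l , d , ds) → subst (Length _) (ℕ.m+[n∸m]≡n (ℕ.≤-pred m<1+l)) (d ∷ ds))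
    (λ { (_∷_ {m = m} {l = l′} d ds) →
         m , s≤s (ℕ.m≤m+n m l′) , d , subst (Length _) (sym (ℕ.m+n∸m≡n m l′)) ds })
    (ℕ.anyUpTo? (λ m → Distance? x y m ×-dec Length? (y ∷ xs) (l ∸ m)) (suc l))

  _++ᵖ_ : ∀ {m n x y z} → Path m x y → Path n y z → Path (m + n) x z
  ε       ++ᵖ q = q
  (e ◅ p) ++ᵖ q = e ◅ (p ++ᵖ q)

  shortest-path : ∀ {n x y} → Path n x y → ∃[ m ] m ≤ n × Distance x y m
  shortest-path {n} {x} {y} p = search n 0 (ℕ.+-identityʳ n) (λ _ → z≤n)
    where
    search : ∀ j k → j + k ≡ n → (∀ {i} → Path i x y → k ≤ i) → ∃[ m ] m ≤ n × Distance x y m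
    search zero    k refl k≤ = k , ℕ.≤-refl , p , k≤
    search (suc j) k refl k≤ with Path? k x y
    ... | yes q = k , ℕ.m≤n+m k (suc j) , q , k≤
    ... | no ¬q = search j (suc k) (ℕ.+-suc j k)
                    (λ q → ℕ.≤∧≢⇒< (k≤ q) (λ { refl → ¬q q }))

  Distance-unique : ∀ {x y m n} → Distance x y m → Distance x y n → m ≡ n
  Distance-unique (p , p-min) (q , q-min) = ℕ.≤-antisym (p-min q) (q-min p)

  Length-unique : ∀ {k} {xs : Vec V (suc k)} {l l′} → Length xs l → Length xs l′ → l ≡ l′
  Length-unique [-]      [-]        = refl
  Length-unique (d ∷ ds) (d′ ∷ ds′) with refl ← Distance-unique d d′ = cong (_ +_) (Length-unique ds ds′)

  interior : ∀ {k} → Fin k → Fin (suc (suc k))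
  interior i = suc (inject₁ i)

  Length-removeAt : ∀ {k l} {xs : Vec V (suc (suc k))} (i : Fin k) → Length xs l →
                    ∃[ l′ ] l′ ≤ l × Length (removeAt xs (interior i)) l′
  Length-removeAt {xs = x ∷ y ∷ z ∷ xs} zero (_∷_ {m = m} (p , _) (_∷_ {m = n} {l = l} (q , _) ds)) =
    let (o , o≤m+n , d) = shortest-path (p ++ᵖ q)
    in o + l , ℕ.≤-trans (ℕ.+-monoˡ-≤ l o≤m+n) (ℕ.≤-reflexive (ℕ.+-assoc m n l)) , d ∷ ds
  Length-removeAt {xs = x ∷ y ∷ z ∷ w ∷ xs} (suc i) (_∷_ {m = m} d ds) =
    let (l′ , l′≤l , ds′) = Length-removeAt i ds
    in m + l′ , ℕ.+-monoʳ-≤ m l′≤l , d ∷ ds′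

  Length-intermediate : ∀ {k l} {xs : Vec V (suc (suc (suc k)))} (j : Fin (suc k)) (i : Fin k) →
                        Length xs l → Length (removeAt (removeAt xs (interior j)) (interior i)) l →
                        Length (removeAt xs (interior j)) l
  Length-intermediate j i ds ds″ with Length-removeAt j ds
  ... | l′ , l′≤l , ds′ with Length-removeAt i ds′
  ... | l″ , l″≤l′ , ds‴ with refl ← Length-unique ds″ ds‴ =
    subst (Length _) (ℕ.≤-antisym l′≤l l″≤l′) ds′

module OverRing {c ℓ : Level} (R : CommutativeRing c ℓ) where
  private module R = CommutativeRing R
  open Exponentiation R.semiring using (_^_)

  -- R being commutative, its modules may be taken to be left modules.
  RModule : (m ℓm : Level) → Set (c ⊔ ℓ ⊔ lsuc (m ⊔ ℓm))
  RModule = LeftModule R.ring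

  open LeftModule using (rawLeftModule)

  infix 4 _≅_

  record LinearMap {m ℓm n ℓn : Level} (M : RModule m ℓm) (N : RModule n ℓn)
                   : Set (c ⊔ m ⊔ ℓm ⊔ n ⊔ ℓn) where
    open LeftModuleMorphisms (rawLeftModule M) (rawLeftModule N)
    field
      ⟦_⟧                      : LeftModule.Carrierᴹ M → LeftModule.Carrierᴹ N
      isLeftModuleHomomorphism : IsLeftModuleHomomorphism ⟦_⟧
    open IsLeftModuleHomomorphism isLeftModuleHomomorphism public

  _≅_ : {m ℓm n ℓn : Level} → RModule m ℓm → RModule n ℓn → Set (c ⊔ m ⊔ ℓm ⊔ n ⊔ ℓn)
  M ≅ N = ∃[ f ] IsLeftModuleIsomorphism f
    where open LeftModuleMorphisms (rawLeftModule M) (rawLeftModule N)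

  IsZero : {m ℓm : Level} → RModule m ℓm → Set (m ⊔ ℓm)
  IsZero M = ∀ x → x ≈ᴹ 0ᴹ
    where open LeftModule M

  module _ {m ℓm n ℓn : Level} {M : RModule m ℓm} {N : RModule n ℓn} where
    private
      module M = LeftModule M
      module N = LeftModule N

    linearMap : (f : M.Carrierᴹ → N.Carrierᴹ) →
                (∀ {x y} → x M.≈ᴹ y → f x N.≈ᴹ f y) →
                (∀ x y → f (x M.+ᴹ y) N.≈ᴹ f x N.+ᴹ f y) →
                (∀ r x → f (r M.*ₗ x) N.≈ᴹ r N.*ₗ f x) →
                LinearMap M N
    linearMap f f-cong f-+ f-* = record
      { ⟦_⟧ = f
      ; isLeftModuleHomomorphism = record
        { +ᴹ-isGroupHomomorphism = record
          { isMonoidHomomorphism = record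
            { isMagmaHomomorphism = record
              { isRelHomomorphism = record { cong = f-cong } ; homo = f-+ }
            ; ε-homo = f-0
            }
          ; ⁻¹-homo = λ x → inverseˡ-unique _ _ (N.≈ᴹ-trans (N.≈ᴹ-sym (f-+ (M.-ᴹ x) x))
                              (N.≈ᴹ-trans (f-cong (M.-ᴹ‿inverseˡ x)) f-0))
          }
        ; *ₗ-homo = f-*
        }
      }
      where
      open AbelianGroupProperties N.+ᴹ-abelianGroup using (inverseˡ-unique)
      f-0 : f M.0ᴹ N.≈ᴹ N.0ᴹ
      f-0 = N.≈ᴹ-trans (f-cong (M.≈ᴹ-sym (M.*ₗ-zeroˡ M.0ᴹ)))
              (N.≈ᴹ-trans (f-* _ M.0ᴹ) (N.*ₗ-zeroˡ (f M.0ᴹ)))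

  compose : {m ℓm n ℓn p ℓp : Level} {M : RModule m ℓm} {N : RModule n ℓn} {P : RModule p ℓp} →
            LinearMap M N → LinearMap N P → LinearMap M P
  compose {M = M} {P = P} f g = linearMap {M = M} {N = P} (g.⟦_⟧ ∘ f.⟦_⟧)
    (λ x≈y → g.⟦⟧-cong (f.⟦⟧-cong x≈y))
    (λ x y → ≈ᴹ-trans (g.⟦⟧-cong (f.+ᴹ-homo x y)) (g.+ᴹ-homo f.⟦ x ⟧ f.⟦ y ⟧))
    (λ r x → ≈ᴹ-trans (g.⟦⟧-cong (f.*ₗ-homo r x)) (g.*ₗ-homo r f.⟦ x ⟧))
    where
    module f = LinearMap f
    module g = LinearMap g
    open LeftModule P using (≈ᴹ-trans)

  record Submodule {m ℓm : Level} (M : RModule m ℓm) (p : Level)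
                   : Set (c ⊔ m ⊔ ℓm ⊔ lsuc p) where
    open LeftModule M using (Carrierᴹ; _≈ᴹ_; 0ᴹ; _+ᴹ_; _*ₗ_)
    field
      Member : Pred Carrierᴹ p
      resp   : ∀ {x y} → x ≈ᴹ y → Member x → Member y
      0∈     : Member 0ᴹ
      +∈     : ∀ {x y} → Member x → Member y → Member (x +ᴹ y)
      *∈     : ∀ r {x} → Member x → Member (r *ₗ x)

  module _ {m ℓm : Level} {M : RModule m ℓm} where
    open LeftModule M

    -1*ₗ : ∀ x → (R.- R.1#) *ₗ x ≈ᴹ -ᴹ x
    -1*ₗ x = inverseˡ-unique _ _ (begin
      (R.- R.1#) *ₗ x +ᴹ x          ≈⟨ +ᴹ-congˡ (*ₗ-identityˡ x) ⟨
      (R.- R.1#) *ₗ x +ᴹ R.1# *ₗ x  ≈⟨ *ₗ-distribʳ x (R.- R.1#) R.1# ⟨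
      ((R.- R.1#) R.+ R.1#) *ₗ x    ≈⟨ *ₗ-congʳ (R.-‿inverseˡ R.1#) ⟩
      R.0# *ₗ x                     ≈⟨ *ₗ-zeroˡ x ⟩
      0ᴹ                            ∎)
      where
      open AbelianGroupProperties +ᴹ-abelianGroup using (inverseˡ-unique)
      open SetoidReasoning ≈ᴹ-setoid

    *ₗ-neg : ∀ r x → r *ₗ (-ᴹ x) ≈ᴹ -ᴹ (r *ₗ x)
    *ₗ-neg r x = inverseˡ-unique _ _
      (≈ᴹ-trans (≈ᴹ-sym (*ₗ-distribˡ r (-ᴹ x) x))
        (≈ᴹ-trans (*ₗ-congˡ (-ᴹ‿inverseˡ x)) (*ₗ-zeroʳ r)))
      where open AbelianGroupProperties +ᴹ-abelianGroup using (inverseˡ-unique)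

    -∈ : {p : Level} (N : Submodule M p) → ∀ {x} → Submodule.Member N x → Submodule.Member N (-ᴹ x)
    -∈ N {x} x∈N = Submodule.resp N (-1*ₗ x) (Submodule.*∈ N (R.- R.1#) x∈N)

    toModule : {p : Level} → Submodule M p → RModule (m ⊔ p) ℓm
    toModule N = record
      { Carrierᴹ = Σ[ x ∈ Carrierᴹ ] Member x
      ; _≈ᴹ_     = λ x y → proj₁ x ≈ᴹ proj₁ y
      ; _+ᴹ_     = λ x y → proj₁ x +ᴹ proj₁ y , +∈ (proj₂ x) (proj₂ y)
      ; _*ₗ_     = λ r x → r *ₗ proj₁ x , *∈ r (proj₂ x)
      ; 0ᴹ       = 0ᴹ , 0∈
      ; -ᴹ_      = λ x → -ᴹ proj₁ x , -∈ N (proj₂ x)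
      ; isLeftModule = record
        { isLeftSemimodule = record
          { +ᴹ-isCommutativeMonoid = record
            { isMonoid = record
              { isSemigroup = record
                { isMagma = record
                  { isEquivalence = On.isEquivalence proj₁ ≈ᴹ-isEquivalence
                  ; ∙-cong        = +ᴹ-cong
                  }
                ; assoc = λ x y z → +ᴹ-assoc (proj₁ x) (proj₁ y) (proj₁ z)
                }
              ; identity = (λ x → +ᴹ-identityˡ (proj₁ x)) , (λ x → +ᴹ-identityʳ (proj₁ x))
              }
            ; comm = λ x y → +ᴹ-comm (proj₁ x) (proj₁ y)
            }
          ; isPreleftSemimodule = record
            { *ₗ-cong      = *ₗ-cong
            ; *ₗ-zeroˡ     = λ x → *ₗ-zeroˡ (proj₁ x)
            ; *ₗ-distribʳ  = λ x → *ₗ-distribʳ (proj₁ x)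
            ; *ₗ-identityˡ = λ x → *ₗ-identityˡ (proj₁ x)
            ; *ₗ-assoc     = λ r s x → *ₗ-assoc r s (proj₁ x)
            ; *ₗ-zeroʳ     = *ₗ-zeroʳ
            ; *ₗ-distribˡ  = λ r x y → *ₗ-distribˡ r (proj₁ x) (proj₁ y)
            }
          }
        ; -ᴹ‿cong    = -ᴹ‿cong
        ; -ᴹ‿inverse = (λ x → -ᴹ‿inverseˡ (proj₁ x)) , (λ x → -ᴹ‿inverseʳ (proj₁ x))
        }
      }
      where open Submodule N

    infixl 6 _-ᴹ_
    _-ᴹ_ : Carrierᴹ → Carrierᴹ → Carrierᴹ
    x -ᴹ y = x +ᴹ (-ᴹ y)

    private
      open AbelianGroupProperties +ᴹ-abelianGroup using (⁻¹-∙-comm; ⁻¹-involutive)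
      open CommutativeSemigroupProperties (CommutativeMonoid.commutativeSemigroup +ᴹ-commutativeMonoid)
        using (interchange)
      open SetoidReasoning ≈ᴹ-setoid

      -ᴹ-+ : ∀ x y → -ᴹ (x +ᴹ y) ≈ᴹ (-ᴹ x) +ᴹ (-ᴹ y)
      -ᴹ-+ x y = ≈ᴹ-sym (⁻¹-∙-comm x y)

    quotient : {p : Level} → Submodule M p → RModule m p
    quotient N = record
      { Carrierᴹ = Carrierᴹ
      ; _≈ᴹ_     = _~_
      ; _+ᴹ_     = _+ᴹ_
      ; _*ₗ_     = _*ₗ_
      ; 0ᴹ       = 0ᴹ
      ; -ᴹ_      = -ᴹ_
      ; isLeftModule = record
        { isLeftSemimodule = record
          { +ᴹ-isCommutativeMonoid = record
            { isMonoid = record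
              { isSemigroup = record
                { isMagma = record
                  { isEquivalence = record { refl = ≈⇒~ ≈ᴹ-refl ; sym = ~-sym ; trans = ~-trans }
                  ; ∙-cong        = ~-+
                  }
                ; assoc = λ x y z → ≈⇒~ (+ᴹ-assoc x y z)
                }
              ; identity = (λ x → ≈⇒~ (+ᴹ-identityˡ x)) , (λ x → ≈⇒~ (+ᴹ-identityʳ x))
              }
            ; comm = λ x y → ≈⇒~ (+ᴹ-comm x y)
            }
          ; isPreleftSemimodule = record
            { *ₗ-cong      = λ {r} {s} {x} r≈s x~y → ~-trans (≈⇒~ (*ₗ-congʳ {x} r≈s)) (~-* s x~y)
            ; *ₗ-zeroˡ     = λ x → ≈⇒~ (*ₗ-zeroˡ x)
            ; *ₗ-distribʳ  = λ x r s → ≈⇒~ (*ₗ-distribʳ x r s)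
            ; *ₗ-identityˡ = λ x → ≈⇒~ (*ₗ-identityˡ x)
            ; *ₗ-assoc     = λ r s x → ≈⇒~ (*ₗ-assoc r s x)
            ; *ₗ-zeroʳ     = λ r → ≈⇒~ (*ₗ-zeroʳ r)
            ; *ₗ-distribˡ  = λ r x y → ≈⇒~ (*ₗ-distribˡ r x y)
            }
          }
        ; -ᴹ‿cong    = ~-neg
        ; -ᴹ‿inverse = (λ x → ≈⇒~ (-ᴹ‿inverseˡ x)) , (λ x → ≈⇒~ (-ᴹ‿inverseʳ x))
        }
      }
      where
      open Submodule N
      _~_ : Rel (Carrierᴹ) _
      x ~ y = Member (x -ᴹ y)

      ≈⇒~ : ∀ {x y} → x ≈ᴹ y → x ~ y
      ≈⇒~ {x} {y} x≈y = resp (≈ᴹ-sym (≈ᴹ-trans (+ᴹ-congʳ x≈y) (-ᴹ‿inverseʳ y))) 0∈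

      ~-sym : ∀ {x y} → x ~ y → y ~ x
      ~-sym {x} {y} x~y = resp (begin
        -ᴹ (x -ᴹ y)           ≈⟨ -ᴹ-+ x (-ᴹ y) ⟩
        (-ᴹ x) +ᴹ (-ᴹ -ᴹ y)   ≈⟨ +ᴹ-congˡ (⁻¹-involutive y) ⟩
        (-ᴹ x) +ᴹ y           ≈⟨ +ᴹ-comm (-ᴹ x) y ⟩
        y -ᴹ x                ∎) (-∈ N x~y)

      ~-trans : ∀ {x y z} → x ~ y → y ~ z → x ~ z
      ~-trans {x} {y} {z} x~y y~z = resp (begin
        (x -ᴹ y) +ᴹ (y -ᴹ z)          ≈⟨ +ᴹ-assoc x (-ᴹ y) (y -ᴹ z) ⟩
        x +ᴹ ((-ᴹ y) +ᴹ (y -ᴹ z))     ≈⟨ +ᴹ-congˡ (+ᴹ-assoc (-ᴹ y) y (-ᴹ z)) ⟨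
        x +ᴹ (((-ᴹ y) +ᴹ y) -ᴹ z)     ≈⟨ +ᴹ-congˡ (+ᴹ-congʳ (-ᴹ‿inverseˡ y)) ⟩
        x +ᴹ (0ᴹ -ᴹ z)                ≈⟨ +ᴹ-congˡ (+ᴹ-identityˡ (-ᴹ z)) ⟩
        x -ᴹ z                        ∎) (+∈ x~y y~z)

      ~-+ : ∀ {x y u v} → x ~ y → u ~ v → (x +ᴹ u) ~ (y +ᴹ v)
      ~-+ {x} {y} {u} {v} x~y u~v = resp (begin
        (x -ᴹ y) +ᴹ (u -ᴹ v)              ≈⟨ interchange x (-ᴹ y) u (-ᴹ v) ⟩
        (x +ᴹ u) +ᴹ ((-ᴹ y) +ᴹ (-ᴹ v))    ≈⟨ +ᴹ-congˡ (-ᴹ-+ y v) ⟨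
        (x +ᴹ u) -ᴹ (y +ᴹ v)              ∎) (+∈ x~y u~v)

      ~-* : ∀ r {x y} → x ~ y → (r *ₗ x) ~ (r *ₗ y)
      ~-* r {x} {y} x~y = resp (begin
        r *ₗ (x -ᴹ y)             ≈⟨ *ₗ-distribˡ r x (-ᴹ y) ⟩
        r *ₗ x +ᴹ r *ₗ (-ᴹ y)     ≈⟨ +ᴹ-congˡ (*ₗ-neg r y) ⟩
        r *ₗ x -ᴹ r *ₗ y          ∎) (*∈ r x~y)

      ~-neg : ∀ {x y} → x ~ y → (-ᴹ x) ~ (-ᴹ y)
      ~-neg {x} {y} x~y = resp (-ᴹ-+ x (-ᴹ y)) (-∈ N x~y)

    whole : (p : Level) → Submodule M p
    whole p = record { Member = λ _ → ⊤ }

    infixr 7 _∩_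
    _∩_ : {p q : Level} → Submodule M p → Submodule M q → Submodule M (p ⊔ q)
    N ∩ N′ = record
      { Member = λ x → N.Member x × N′.Member x
      ; resp   = λ x≈y (x∈N , x∈N′) → N.resp x≈y x∈N , N′.resp x≈y x∈N′
      ; 0∈     = N.0∈ , N′.0∈
      ; +∈     = λ (x∈N , x∈N′) (y∈N , y∈N′) → N.+∈ x∈N y∈N , N′.+∈ x∈N′ y∈N′
      ; *∈     = λ r (x∈N , x∈N′) → N.*∈ r x∈N , N′.*∈ r x∈N′
      }
      where
      module N  = Submodule N
      module N′ = Submodule N′

    module _ {i : Level} {I : Set i} (b : I → Carrierᴹ) where

      data InSpan : Carrierᴹ → Set (c ⊔ i ⊔ m ⊔ ℓm) where
        gen-∈  : ∀ j → InSpan (b j)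
        resp-∈ : ∀ {x y} → x ≈ᴹ y → InSpan x → InSpan y
        0-∈    : InSpan 0ᴹ
        +-∈    : ∀ {x y} → InSpan x → InSpan y → InSpan (x +ᴹ y)
        *-∈    : ∀ r {x} → InSpan x → InSpan (r *ₗ x)

      span : Submodule M (c ⊔ i ⊔ m ⊔ ℓm)
      span = record { Member = InSpan ; resp = resp-∈ ; 0∈ = 0-∈ ; +∈ = +-∈ ; *∈ = *-∈ }

  module _ {m ℓm n ℓn : Level} {M : RModule m ℓm} {N : RModule n ℓn} (f : LinearMap M N) where
    private
      module M = LeftModule M
      module N = LeftModule N
    open LinearMap f

    preimage : {p : Level} → Submodule N p → Submodule M p
    preimage P = record
      { Member = λ x → Member ⟦ x ⟧
      ; resp   = λ x≈y → resp (⟦⟧-cong x≈y)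
      ; 0∈     = resp (N.≈ᴹ-sym 0ᴹ-homo) 0∈
      ; +∈     = λ {x} {y} x∈ y∈ → resp (N.≈ᴹ-sym (+ᴹ-homo x y)) (+∈ x∈ y∈)
      ; *∈     = λ r {x} x∈ → resp (N.≈ᴹ-sym (*ₗ-homo r x)) (*∈ r x∈)
      }
      where open Submodule P

    kernel : Submodule M ℓn
    kernel = record
      { Member = λ x → ⟦ x ⟧ N.≈ᴹ N.0ᴹ
      ; resp   = λ x≈y x∈ → N.≈ᴹ-trans (⟦⟧-cong (M.≈ᴹ-sym x≈y)) x∈
      ; 0∈     = 0ᴹ-homo
      ; +∈     = λ {x} {y} x∈ y∈ → N.≈ᴹ-trans (+ᴹ-homo x y)
                   (N.≈ᴹ-trans (N.+ᴹ-cong x∈ y∈) (N.+ᴹ-identityˡ N.0ᴹ))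
      ; *∈     = λ r {x} x∈ → N.≈ᴹ-trans (*ₗ-homo r x)
                   (N.≈ᴹ-trans (N.*ₗ-congˡ x∈) (N.*ₗ-zeroʳ r))
      }

    image : Submodule N (m ⊔ ℓn)
    image = record
      { Member = λ y → ∃[ x ] ⟦ x ⟧ N.≈ᴹ y
      ; resp   = λ y≈z (x , fx≈y) → x , N.≈ᴹ-trans fx≈y y≈z
      ; 0∈     = M.0ᴹ , 0ᴹ-homo
      ; +∈     = λ (x , fx≈) (y , fy≈) → x M.+ᴹ y , N.≈ᴹ-trans (+ᴹ-homo x y) (N.+ᴹ-cong fx≈ fy≈)
      ; *∈     = λ r (x , fx≈) → r M.*ₗ x , N.≈ᴹ-trans (*ₗ-homo r x) (N.*ₗ-congˡ fx≈)
      }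

  inclusion : {m ℓm p : Level} {M : RModule m ℓm} (N : Submodule M p) → LinearMap (toModule N) M
  inclusion {M = M} N = linearMap {M = toModule N} {N = M} proj₁ (λ x≈y → x≈y) (λ _ _ → ≈ᴹ-refl) (λ _ _ → ≈ᴹ-refl)
    where open LeftModule M

  -- There is no differential out of degree 0.
  record ChainComplex (m ℓm : Level) : Set (c ⊔ ℓ ⊔ lsuc (m ⊔ ℓm)) where
    field
      C    : ℕ → RModule m ℓm
      d    : ∀ n → LinearMap (C (suc n)) (C n)

    ∂ : ∀ n → LeftModule.Carrierᴹ (C (suc n)) → LeftModule.Carrierᴹ (C n)
    ∂ n = LinearMap.⟦_⟧ (d n)

    field
      ∂∂≈0 : ∀ n v → LeftModule._≈ᴹ_ (C n) (∂ n (∂ (suc n) v)) (LeftModule.0ᴹ (C n))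

  module _ {m ℓm : Level} (K : ChainComplex m ℓm) where
    open ChainComplex K

    cycles : ∀ n → Submodule (C n) ℓm
    cycles zero    = whole ℓm
    cycles (suc n) = kernel (d n)

    boundaries : ∀ n → Submodule (C n) (m ⊔ ℓm)
    boundaries n = image (d n)

    -- Cycles modulo those cycles that are boundaries; two cycles are equal
    -- in H n when their difference is a boundary.
    H : ℕ → RModule (m ⊔ ℓm) (m ⊔ ℓm)
    H n = quotient (preimage (inclusion (cycles n)) (boundaries n))

    subcomplex : {p : Level} (N : ∀ n → Submodule (C n) p) →
                 (∀ n {v} → Submodule.Member (N (suc n)) v → Submodule.Member (N n) (∂ n v)) →
                 ChainComplex (m ⊔ p) ℓm
    subcomplex N closed = record
      { C    = λ n → toModule (N n)
      ; d    = λ n → linearMap {M = toModule (N (suc n))} {N = toModule (N n)}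
                 (λ (v , v∈) → ∂ n v , closed n v∈)
                 (⟦⟧-cong (d n))
                 (λ x y → +ᴹ-homo (d n) (proj₁ x) (proj₁ y))
                 (λ r x → *ₗ-homo (d n) r (proj₁ x))
      ; ∂∂≈0 = λ n v → ∂∂≈0 n (proj₁ v)
      }
      where open LinearMap

  -- The free R-module on a setoid: formal R-linear expressions in the
  -- elements of S, modulo the congruence generated by the module axioms
  -- and the equality of S.
  module FreeModule {a e : Level} (S : Setoid a e) where
    private module S = Setoid S

    infixr 8 -_
    infixr 7 _·_
    infixl 6 _⊕_
    infix 4 _≋_

    data Term : Set (c ⊔ a) where
      gen : S.Carrier → Term
      𝟎   : Term
      _⊕_ : Term → Term → Term
      -_  : Term → Term
      _·_ : R.Carrier → Term → Term

    data _≋_ : Rel Term (c ⊔ ℓ ⊔ a ⊔ e) where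
      ≋-refl     : ∀ {t} → t ≋ t
      ≋-sym      : ∀ {t u} → t ≋ u → u ≋ t
      ≋-trans    : ∀ {t u v} → t ≋ u → u ≋ v → t ≋ v
      gen-cong   : ∀ {x y} → x S.≈ y → gen x ≋ gen y
      ⊕-cong     : ∀ {t t′ u u′} → t ≋ t′ → u ≋ u′ → t ⊕ u ≋ t′ ⊕ u′
      neg-cong   : ∀ {t u} → t ≋ u → - t ≋ - u
      ·-cong     : ∀ {r s t u} → r R.≈ s → t ≋ u → r · t ≋ s · u
      ⊕-assoc    : ∀ t u v → (t ⊕ u) ⊕ v ≋ t ⊕ (u ⊕ v)
      ⊕-comm     : ∀ t u → t ⊕ u ≋ u ⊕ t
      ⊕-identity : ∀ t → 𝟎 ⊕ t ≋ t
      ⊕-inverse  : ∀ t → (- t) ⊕ t ≋ 𝟎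
      ·-zeroˡ    : ∀ t → R.0# · t ≋ 𝟎
      ·-zeroʳ    : ∀ r → r · 𝟎 ≋ 𝟎
      ·-distribˡ : ∀ r t u → r · (t ⊕ u) ≋ r · t ⊕ r · u
      ·-distribʳ : ∀ t r s → (r R.+ s) · t ≋ r · t ⊕ s · t
      ·-assoc    : ∀ r s t → (r R.* s) · t ≋ r · (s · t)
      ·-identity : ∀ t → R.1# · t ≋ t

    free : RModule (c ⊔ a) (c ⊔ ℓ ⊔ a ⊔ e)
    free = record
      { Carrierᴹ = Term
      ; _≈ᴹ_     = _≋_
      ; _+ᴹ_     = _⊕_
      ; _*ₗ_     = _·_
      ; 0ᴹ       = 𝟎
      ; -ᴹ_      = -_
      ; isLeftModule = record
        { isLeftSemimodule = record
          { +ᴹ-isCommutativeMonoid = record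
            { isMonoid = record
              { isSemigroup = record
                { isMagma = record
                  { isEquivalence = record { refl = ≋-refl ; sym = ≋-sym ; trans = ≋-trans }
                  ; ∙-cong        = ⊕-cong
                  }
                ; assoc = ⊕-assoc
                }
              ; identity = ⊕-identity , λ t → ≋-trans (⊕-comm t 𝟎) (⊕-identity t)
              }
            ; comm = ⊕-comm
            }
          ; isPreleftSemimodule = record
            { *ₗ-cong      = ·-cong
            ; *ₗ-zeroˡ     = ·-zeroˡ
            ; *ₗ-distribʳ  = ·-distribʳ
            ; *ₗ-identityˡ = ·-identity
            ; *ₗ-assoc     = ·-assoc
            ; *ₗ-zeroʳ     = ·-zeroʳ
            ; *ₗ-distribˡ  = ·-distribˡ
            }
          }
        ; -ᴹ‿cong    = neg-cong
        ; -ᴹ‿inverse = ⊕-inverse , λ t → ≋-trans (⊕-comm t (- t)) (⊕-inverse t)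
        }
      }

    module _ {m ℓm : Level} {M : RModule m ℓm} where
      open LeftModule M

      extend : Func S ≈ᴹ-setoid → LinearMap free M
      extend f = linearMap {M = free} {N = M} ⟦_⟧ ⟦⟧-cong (λ _ _ → ≈ᴹ-refl) (λ _ _ → ≈ᴹ-refl)
        where
        ⟦_⟧ : Term → Carrierᴹ
        ⟦ gen x ⟧ = Func.to f x
        ⟦ 𝟎 ⟧     = 0ᴹ
        ⟦ t ⊕ u ⟧ = ⟦ t ⟧ +ᴹ ⟦ u ⟧
        ⟦ - t ⟧   = -ᴹ ⟦ t ⟧
        ⟦ r · t ⟧ = r *ₗ ⟦ t ⟧

        ⟦⟧-cong : ∀ {t u} → t ≋ u → ⟦ t ⟧ ≈ᴹ ⟦ u ⟧
        ⟦⟧-cong ≋-refl             = ≈ᴹ-refl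
        ⟦⟧-cong (≋-sym p)          = ≈ᴹ-sym (⟦⟧-cong p)
        ⟦⟧-cong (≋-trans p q)      = ≈ᴹ-trans (⟦⟧-cong p) (⟦⟧-cong q)
        ⟦⟧-cong (gen-cong x≈y)     = Func.cong f x≈y
        ⟦⟧-cong (⊕-cong p q)       = +ᴹ-cong (⟦⟧-cong p) (⟦⟧-cong q)
        ⟦⟧-cong (neg-cong p)       = -ᴹ‿cong (⟦⟧-cong p)
        ⟦⟧-cong (·-cong r≈s p)     = *ₗ-cong r≈s (⟦⟧-cong p)
        ⟦⟧-cong (⊕-assoc t u v)    = +ᴹ-assoc ⟦ t ⟧ ⟦ u ⟧ ⟦ v ⟧
        ⟦⟧-cong (⊕-comm t u)       = +ᴹ-comm ⟦ t ⟧ ⟦ u ⟧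
        ⟦⟧-cong (⊕-identity t)     = +ᴹ-identityˡ ⟦ t ⟧
        ⟦⟧-cong (⊕-inverse t)      = -ᴹ‿inverseˡ ⟦ t ⟧
        ⟦⟧-cong (·-zeroˡ t)        = *ₗ-zeroˡ ⟦ t ⟧
        ⟦⟧-cong (·-zeroʳ r)        = *ₗ-zeroʳ r
        ⟦⟧-cong (·-distribˡ r t u) = *ₗ-distribˡ r ⟦ t ⟧ ⟦ u ⟧
        ⟦⟧-cong (·-distribʳ t r s) = *ₗ-distribʳ ⟦ t ⟧ r s
        ⟦⟧-cong (·-assoc r s t)    = *ₗ-assoc r s ⟦ t ⟧
        ⟦⟧-cong (·-identity t)     = *ₗ-identityˡ ⟦ t ⟧

      extensionality : (f g : LinearMap free M) →
                       (∀ x → LinearMap.⟦_⟧ f (gen x) ≈ᴹ LinearMap.⟦_⟧ g (gen x)) →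
                       ∀ t → LinearMap.⟦_⟧ f t ≈ᴹ LinearMap.⟦_⟧ g t
      extensionality f g f≈g = go
        where
        module f = LinearMap f
        module g = LinearMap g
        go : ∀ t → f.⟦ t ⟧ ≈ᴹ g.⟦ t ⟧
        go (gen x) = f≈g x
        go 𝟎       = ≈ᴹ-trans f.0ᴹ-homo (≈ᴹ-sym g.0ᴹ-homo)
        go (t ⊕ u) = ≈ᴹ-trans (f.+ᴹ-homo t u)
                       (≈ᴹ-trans (+ᴹ-cong (go t) (go u)) (≈ᴹ-sym (g.+ᴹ-homo t u)))
        go (- t)   = ≈ᴹ-trans (f.-ᴹ-homo t) (≈ᴹ-trans (-ᴹ‿cong (go t)) (≈ᴹ-sym (g.-ᴹ-homo t)))
        go (r · t) = ≈ᴹ-trans (f.*ₗ-homo r t)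
                       (≈ᴹ-trans (*ₗ-congˡ (go t)) (≈ᴹ-sym (g.*ₗ-homo r t)))

    genᶠ : Func S (LeftModule.≈ᴹ-setoid free)
    genᶠ = record { to = gen ; cong = gen-cong }

  sign : ℕ → R.Carrier
  sign k = (R.- R.1#) ^ k

  module Alternation {m ℓm : Level} (M : RModule m ℓm) where
    open LeftModule M
    open CommutativeMonoidSum +ᴹ-commutativeMonoid using (sum)
    open AbelianGroupProperties +ᴹ-abelianGroup using (⁻¹-∙-comm; ε⁻¹≈ε)
    open CommutativeSemigroupProperties (CommutativeMonoid.commutativeSemigroup +ᴹ-commutativeMonoid)
      using (interchange)
    open SetoidReasoning ≈ᴹ-setoid

    alt : ∀ {n} → (Fin n → Carrierᴹ) → Carrierᴹ
    alt {zero}  x = 0ᴹ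
    alt {suc n} x = x zero +ᴹ (-ᴹ alt (x ∘ suc))

    alt-cong : ∀ {n} {x y : Fin n → Carrierᴹ} → (∀ i → x i ≈ᴹ y i) → alt x ≈ᴹ alt y
    alt-cong {zero}  x≈y = ≈ᴹ-refl
    alt-cong {suc n} x≈y = +ᴹ-cong (x≈y zero) (-ᴹ‿cong (alt-cong (x≈y ∘ suc)))

    alt-sub : ∀ {n} (x y : Fin n → Carrierᴹ) →
              alt (λ i → x i +ᴹ (-ᴹ y i)) ≈ᴹ alt x +ᴹ (-ᴹ alt y)
    alt-sub {zero}  x y = ≈ᴹ-sym (-ᴹ‿inverseʳ 0ᴹ)
    alt-sub {suc n} x y = begin
      (x zero +ᴹ (-ᴹ y zero)) +ᴹ (-ᴹ alt (λ i → x (suc i) +ᴹ (-ᴹ y (suc i))))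
        ≈⟨ +ᴹ-congˡ (-ᴹ‿cong (alt-sub (x ∘ suc) (y ∘ suc))) ⟩
      (x zero +ᴹ (-ᴹ y zero)) +ᴹ (-ᴹ (alt (x ∘ suc) +ᴹ (-ᴹ alt (y ∘ suc))))
        ≈⟨ +ᴹ-congˡ (⁻¹-∙-comm _ _) ⟨
      (x zero +ᴹ (-ᴹ y zero)) +ᴹ ((-ᴹ alt (x ∘ suc)) +ᴹ (-ᴹ -ᴹ alt (y ∘ suc)))
        ≈⟨ interchange _ _ _ _ ⟩
      alt x +ᴹ ((-ᴹ y zero) +ᴹ (-ᴹ -ᴹ alt (y ∘ suc)))
        ≈⟨ +ᴹ-congˡ (⁻¹-∙-comm _ _) ⟩
      alt x +ᴹ (-ᴹ alt y) ∎

    alt-* : ∀ {n} r (x : Fin n → Carrierᴹ) → alt (λ i → r *ₗ x i) ≈ᴹ r *ₗ alt x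
    alt-* {zero}  r x = ≈ᴹ-sym (*ₗ-zeroʳ r)
    alt-* {suc n} r x = begin
      r *ₗ x zero +ᴹ (-ᴹ alt (λ i → r *ₗ x (suc i)))  ≈⟨ +ᴹ-congˡ (-ᴹ‿cong (alt-* r (x ∘ suc))) ⟩
      r *ₗ x zero +ᴹ (-ᴹ (r *ₗ alt (x ∘ suc)))         ≈⟨ +ᴹ-congˡ (*ₗ-neg {M = M} r _) ⟨
      r *ₗ x zero +ᴹ r *ₗ (-ᴹ alt (x ∘ suc))           ≈⟨ *ₗ-distribˡ r _ _ ⟨
      r *ₗ alt x                                        ∎

    signed-sum : ∀ {n} k (p : Fin n → ℕ) → (∀ i → p i ≡ k + toℕ i) → (x : Fin n → Carrierᴹ) →
                 sum (λ i → sign (p i) *ₗ x i) ≈ᴹ sign k *ₗ alt x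
    signed-sum {zero}  k p p≡ x = ≈ᴹ-sym (*ₗ-zeroʳ (sign k))
    signed-sum {suc n} k p p≡ x = begin
      sign (p zero) *ₗ x zero +ᴹ sum (λ i → sign (p (suc i)) *ₗ x (suc i))
        ≈⟨ +ᴹ-cong (*ₗ-congʳ (R.reflexive (cong sign (trans (p≡ zero) (ℕ.+-identityʳ k)))))
                   (signed-sum (suc k) (p ∘ suc) (λ i → trans (p≡ (suc i)) (ℕ.+-suc k (toℕ i))) (x ∘ suc)) ⟩
      sign k *ₗ x zero +ᴹ sign (suc k) *ₗ alt (x ∘ suc)
        ≈⟨ +ᴹ-congˡ (*ₗ-assoc _ _ _) ⟩
      sign k *ₗ x zero +ᴹ (R.- R.1#) *ₗ (sign k *ₗ alt (x ∘ suc))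
        ≈⟨ +ᴹ-congˡ (-1*ₗ {M = M} _) ⟩
      sign k *ₗ x zero +ᴹ (-ᴹ (sign k *ₗ alt (x ∘ suc)))
        ≈⟨ +ᴹ-congˡ (*ₗ-neg {M = M} _ _) ⟨
      sign k *ₗ x zero +ᴹ sign k *ₗ (-ᴹ alt (x ∘ suc))
        ≈⟨ *ₗ-distribˡ _ _ _ ⟨
      sign k *ₗ alt x ∎

    alt-alt : ∀ {n} (a : Fin n → Fin (suc n) → Carrierᴹ) →
              (∀ i j → toℕ i ≤ toℕ j → a i (suc j) ≈ᴹ a j (inject₁ i)) →
              alt (λ i → alt (a i)) ≈ᴹ 0ᴹ
    alt-alt {zero}  a a-sym = ≈ᴹ-refl
    alt-alt {suc n} a a-sym = begin
      alt (λ i → a i zero +ᴹ (-ᴹ alt (a i ∘ suc)))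
        ≈⟨ alt-sub (λ i → a i zero) (λ i → alt (a i ∘ suc)) ⟩
      alt (λ i → a i zero) +ᴹ (-ᴹ (alt (a zero ∘ suc) +ᴹ (-ᴹ alt (λ i → alt (a (suc i) ∘ suc)))))
        ≈⟨ +ᴹ-congˡ (-ᴹ‿cong (+ᴹ-cong (alt-cong (λ j → a-sym zero j z≤n)) (-ᴹ‿cong rest))) ⟩
      alt (λ i → a i zero) +ᴹ (-ᴹ (alt (λ j → a j zero) +ᴹ (-ᴹ 0ᴹ)))
        ≈⟨ +ᴹ-congˡ (-ᴹ‿cong (≈ᴹ-trans (+ᴹ-congˡ ε⁻¹≈ε) (+ᴹ-identityʳ _))) ⟩
      alt (λ i → a i zero) +ᴹ (-ᴹ alt (λ j → a j zero))
        ≈⟨ -ᴹ‿inverseʳ _ ⟩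
      0ᴹ ∎
      where
      rest : alt (λ i → alt (a (suc i) ∘ suc)) ≈ᴹ 0ᴹ
      rest = alt-alt (λ i j → a (suc i) (suc j)) (λ i j i≤j → a-sym (suc i) (suc j) (s≤s i≤j))

  module _ {m ℓm n ℓn : Level} {M : RModule m ℓm} {N : RModule n ℓn} where
    private
      module M = LeftModule M
      module N = LeftModule N
      open LinearMap
      open CommutativeMonoidSum N.+ᴹ-commutativeMonoid using (sum; sum-cong-≋; ∑-distrib-+)
      open SetoidReasoning N.≈ᴹ-setoid

      *ₗ-sum : ∀ {k} r (x : Fin k → N.Carrierᴹ) → sum (λ i → r N.*ₗ x i) N.≈ᴹ r N.*ₗ sum x
      *ₗ-sum {zero}  r x = N.≈ᴹ-sym (N.*ₗ-zeroʳ r)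
      *ₗ-sum {suc k} r x = N.≈ᴹ-trans (N.+ᴹ-congˡ (*ₗ-sum r (x ∘ suc))) (N.≈ᴹ-sym (N.*ₗ-distribˡ r _ _))

      *ₗ-swap : ∀ r s x → r N.*ₗ (s N.*ₗ x) N.≈ᴹ s N.*ₗ (r N.*ₗ x)
      *ₗ-swap r s x = begin
        r N.*ₗ (s N.*ₗ x)  ≈⟨ N.*ₗ-assoc r s x ⟨
        (r R.* s) N.*ₗ x   ≈⟨ N.*ₗ-congʳ (R.*-comm r s) ⟩
        (s R.* r) N.*ₗ x   ≈⟨ N.*ₗ-assoc s r x ⟩
        s N.*ₗ (r N.*ₗ x)  ∎

    signedSum : ∀ {k} → (Fin k → ℕ) → (Fin k → LinearMap M N) → LinearMap M N
    signedSum p f = linearMap {M = M} {N = N}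
      (λ v → sum (λ i → sign (p i) N.*ₗ ⟦ f i ⟧ v))
      (λ x≈y → sum-cong-≋ (λ i → N.*ₗ-congˡ (⟦⟧-cong (f i) x≈y)))
      (λ x y → N.≈ᴹ-trans
        (sum-cong-≋ (λ i → N.≈ᴹ-trans (N.*ₗ-congˡ (+ᴹ-homo (f i) x y)) (N.*ₗ-distribˡ _ _ _)))
        (∑-distrib-+ (λ i → sign (p i) N.*ₗ ⟦ f i ⟧ x) (λ i → sign (p i) N.*ₗ ⟦ f i ⟧ y)))
      (λ r x → N.≈ᴹ-trans
        (sum-cong-≋ (λ i → N.≈ᴹ-trans (N.*ₗ-congˡ (*ₗ-homo (f i) r x)) (*ₗ-swap _ r _)))
        (*ₗ-sum r (λ i → sign (p i) N.*ₗ ⟦ f i ⟧ x)))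

  module _ {a ℓa b ℓb e ℓe : Level}
           {A : RModule a ℓa} {B : RModule b ℓb} {E : RModule e ℓe} where
    private
      module B = LeftModule B
      module E = LeftModule E
      open LinearMap
      open SetoidReasoning E.≈ᴹ-setoid
      open Alternation

    ⟦⟧-alt : ∀ {k} (g : LinearMap B E) (x : Fin k → B.Carrierᴹ) →
             ⟦ g ⟧ (alt B x) E.≈ᴹ alt E (λ i → ⟦ g ⟧ (x i))
    ⟦⟧-alt {zero}  g x = 0ᴹ-homo g
    ⟦⟧-alt {suc k} g x = E.≈ᴹ-trans (+ᴹ-homo g _ _)
      (E.+ᴹ-congˡ (E.≈ᴹ-trans (-ᴹ-homo g _) (E.-ᴹ‿cong (⟦⟧-alt g (x ∘ suc)))))

    signedSum-signedSum :
      ∀ {k} s (p : Fin k → ℕ) (q : Fin (suc k) → ℕ) →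
      (∀ i → p i ≡ s + toℕ i) → (∀ j → q j ≡ s + toℕ j) →
      (g : Fin k → LinearMap B E) (f : Fin (suc k) → LinearMap A B) →
      (∀ i j → toℕ i ≤ toℕ j → ∀ v → ⟦ g i ⟧ (⟦ f (suc j) ⟧ v) E.≈ᴹ ⟦ g j ⟧ (⟦ f (inject₁ i) ⟧ v)) →
      ∀ v → ⟦ signedSum {M = B} {N = E} p g ⟧ (⟦ signedSum {M = A} {N = B} q f ⟧ v) E.≈ᴹ E.0ᴹ
    signedSum-signedSum s p q p≡ q≡ g f identity v = begin
      ⟦ signedSum {M = B} {N = E} p g ⟧ (⟦ signedSum {M = A} {N = B} q f ⟧ v)
        ≈⟨ ⟦⟧-cong (signedSum {M = B} {N = E} p g) (signed-sum B s q q≡ (λ j → ⟦ f j ⟧ v)) ⟩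
      ⟦ signedSum {M = B} {N = E} p g ⟧ (sign s B.*ₗ alt B (λ j → ⟦ f j ⟧ v))
        ≈⟨ signed-sum E s p p≡ (λ i → ⟦ g i ⟧ (sign s B.*ₗ alt B (λ j → ⟦ f j ⟧ v))) ⟩
      sign s E.*ₗ alt E (λ i → ⟦ g i ⟧ (sign s B.*ₗ alt B (λ j → ⟦ f j ⟧ v)))
        ≈⟨ E.*ₗ-congˡ (alt-cong E (λ i → E.≈ᴹ-trans (*ₗ-homo (g i) (sign s) _)
                                           (E.*ₗ-congˡ (⟦⟧-alt (g i) (λ j → ⟦ f j ⟧ v))))) ⟩
      sign s E.*ₗ alt E (λ i → sign s E.*ₗ alt E (λ j → ⟦ g i ⟧ (⟦ f j ⟧ v)))
        ≈⟨ E.*ₗ-congˡ (alt-* E (sign s) (λ i → alt E (λ j → ⟦ g i ⟧ (⟦ f j ⟧ v)))) ⟩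
      sign s E.*ₗ (sign s E.*ₗ alt E (λ i → alt E (λ j → ⟦ g i ⟧ (⟦ f j ⟧ v))))
        ≈⟨ E.*ₗ-congˡ (E.*ₗ-congˡ (alt-alt E (λ i j → ⟦ g i ⟧ (⟦ f j ⟧ v))
             (λ i j i≤j → identity i j i≤j v))) ⟩
      sign s E.*ₗ (sign s E.*ₗ E.0ᴹ)
        ≈⟨ E.*ₗ-congˡ (E.*ₗ-zeroʳ _) ⟩
      sign s E.*ₗ E.0ᴹ
        ≈⟨ E.*ₗ-zeroʳ _ ⟩
      E.0ᴹ ∎

  module _ {a e : Level} (X : SemiSimplicialSet a e) where
    open SemiSimplicialSet X
    private
      C : ℕ → RModule (c ⊔ a) (c ⊔ ℓ ⊔ a ⊔ e)
      C n = FreeModule.free (Simplex n)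

    faceMap : ∀ n → Fin (suc (suc n)) → LinearMap (C (suc n)) (C n)
    faceMap n i = extend {M = C n} (face n i ⟶∘ genᶠ (Simplex n))
      where
      open FreeModule (Simplex (suc n)) using (extend)
      open FreeModule using (genᶠ)

    chains : ChainComplex (c ⊔ a) (c ⊔ ℓ ⊔ a ⊔ e)
    chains = record
      { C    = C
      ; d    = λ n → signedSum {M = C (suc n)} {N = C n} toℕ (faceMap n)
      ; ∂∂≈0 = λ n → signedSum-signedSum {A = C (2 + n)} {B = C (1 + n)} {E = C n}
                 0 toℕ toℕ (λ _ → refl) (λ _ → refl) (faceMap n) (faceMap (suc n)) (identity n)
      }
      where
      open LinearMap
      identity : ∀ n i j → toℕ i ≤ toℕ j → ∀ v →
                 LeftModule._≈ᴹ_ (C n)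
                   (⟦ faceMap n i ⟧ (⟦ faceMap (suc n) (suc j) ⟧ v))
                   (⟦ faceMap n j ⟧ (⟦ faceMap (suc n) (inject₁ i) ⟧ v))
      identity n i j i≤j = extensionality {M = C n}
        (compose (faceMap (suc n) (suc j)) (faceMap n i))
        (compose (faceMap (suc n) (inject₁ i)) (faceMap n j))
        (λ x → FreeModule.gen-cong (face-face n i j i≤j x))
        where open FreeModule (Simplex (2 + n)) using (extensionality)

  module _ (G : FiniteDigraph) where
    open FiniteDigraph G

    module _ (l : ℕ) where
      Basis : ℕ → Setoid 0ℓ 0ℓ
      Basis k = tuples {A = V} {n = suc k} (λ x → Unique x × Length G x l)

      private
        C : ℕ → RModule c (c ⊔ ℓ)
        C k = FreeModule.free (Basis k)

      module _ {k : ℕ} where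
        open FreeModule (Basis k)

        genOr0 : (x : Vec V (suc k)) → Unique x → Dec (Length G x l) → Term
        genOr0 x u (yes len) = gen (x , u , len)
        genOr0 x u (no _)    = 𝟎

        genOr0-cong : ∀ {x y} {u : Unique x} {u′ : Unique y} p q → x ≡ y → genOr0 x u p ≋ genOr0 y u′ q
        genOr0-cong (yes _)   (yes _)   x≡y  = gen-cong x≡y
        genOr0-cong (yes len) (no ¬len) refl = contradiction len ¬len
        genOr0-cong (no ¬len) (yes len) refl = contradiction len ¬len
        genOr0-cong (no _)    (no _)    refl = ≋-refl

        genOr0-no : ∀ {x} {u : Unique x} p → ¬ Length G x l → genOr0 x u p ≋ 𝟎
        genOr0-no (yes len) ¬len = contradiction len ¬len
        genOr0-no (no _)    _    = ≋-refl

      deleteOr0 : ∀ k → Fin (suc (suc k)) → LinearMap (C (suc k)) (C k)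
      deleteOr0 k i = FreeModule.extend (Basis (suc k)) {M = C k} (record
        { to   = λ (x , u , _) → genOr0 (removeAt x i) (AllPairs-removeAt i u) (Length? G (removeAt x i) l)
        ; cong = λ {x} {y} x≡y → genOr0-cong (Length? G (removeAt (proj₁ x) i) l) (Length? G (removeAt (proj₁ y) i) l)
                                   (cong (λ z → removeAt z i) x≡y)
        })

      -- Eulerian magnitude chains: a tuple in degree k + 1 has interior positions 1, …, k.
      EMC : ChainComplex c (c ⊔ ℓ)
      EMC = record
        { C    = C
        ; d    = λ k → signedSum {M = C (suc k)} {N = C k} (toℕ ∘ interior G) (deleteOr0 k ∘ interior G)
        ; ∂∂≈0 = λ k → signedSum-signedSum {A = C (2 + k)} {B = C (1 + k)} {E = C k}
                   1 (toℕ ∘ interior G) (toℕ ∘ interior G)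
                   (λ i → cong suc (Fin.toℕ-inject₁ i)) (λ j → cong suc (Fin.toℕ-inject₁ j))
                   (deleteOr0 k ∘ interior G) (deleteOr0 (suc k) ∘ interior G) (identity k)
        }
        where
        open LinearMap

        twice : ∀ k (i : Fin k) (j : Fin (suc k)) (x : Setoid.Carrier (Basis (2 + k))) →
                let y = removeAt (proj₁ x) (interior G j)
                    z = removeAt y (interior G i)
                    u = AllPairs-removeAt (interior G i) (AllPairs-removeAt (interior G j) (proj₁ (proj₂ x)))
                in FreeModule._≋_ (Basis k)
                     (⟦ deleteOr0 k (interior G i) ⟧ (⟦ deleteOr0 (suc k) (interior G j) ⟧ (FreeModule.gen x)))
                     (genOr0 z u (Length? G z l))
        twice k i j (x , _ , len) with Length? G (removeAt x (interior G j)) l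
        ... | yes _   = FreeModule.≋-refl
        ... | no ¬len = FreeModule.≋-sym (genOr0-no (Length? G _ l) (¬len ∘ Length-intermediate G j i len))

        identity : ∀ k (i j : Fin k) → toℕ i ≤ toℕ j → ∀ v →
                   LeftModule._≈ᴹ_ (C k)
                     (⟦ deleteOr0 k (interior G i) ⟧ (⟦ deleteOr0 (suc k) (interior G (suc j)) ⟧ v))
                     (⟦ deleteOr0 k (interior G j) ⟧ (⟦ deleteOr0 (suc k) (interior G (inject₁ i)) ⟧ v))
        identity k i j i≤j = extensionality {M = C k}
          (compose (deleteOr0 (suc k) (interior G (suc j))) (deleteOr0 k (interior G i)))
          (compose (deleteOr0 (suc k) (interior G (inject₁ i))) (deleteOr0 k (interior G j)))
          (λ x → FreeModule.≋-trans (twice k i (suc j) x)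
            (FreeModule.≋-trans
              (genOr0-cong (Length? G _ l) (Length? G _ l)
                (removeAt-removeAt (proj₁ x) (interior G i) (interior G j)
                  (s≤s (subst₂ _≤_ (sym (Fin.toℕ-inject₁ i)) (sym (Fin.toℕ-inject₁ j)) i≤j))))
              (FreeModule.≋-sym (twice k j (inject₁ i) x))))
          where open FreeModule (Basis (2 + k)) using (extensionality)

    EMH : (k l : ℕ) → RModule (c ⊔ ℓ) (c ⊔ ℓ)
    EMH k l = H (EMC l) k

    RegularlyDiagonal : Set (c ⊔ ℓ)
    RegularlyDiagonal = ∀ k l → k ≢ l → IsZero (EMH k l)

    deletion : {P : ∀ {n} → Pred (Vec V (suc n)) 0ℓ} →
               (∀ {n} i {x : Vec V (suc (suc n))} → P x → P (removeAt x i)) →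
               SemiSimplicialSet 0ℓ 0ℓ
    deletion {P} closed = record
      { Simplex   = λ n → tuples (P {n})
      ; face      = λ n i → record
        { to   = λ (x , p) → removeAt x i , closed i p
        ; cong = cong (λ x → removeAt x i)
        }
      ; face-face = λ n i j i≤j x → removeAt-removeAt (proj₁ x) i j i≤j
      }

    AllTuples : SemiSimplicialSet 0ℓ 0ℓ
    AllTuples = deletion {P = λ _ → ⊤} (λ _ _ → tt)

    Λ : ChainComplex c (c ⊔ ℓ)
    Λ = chains AllTuples

    private module Λ = ChainComplex Λ

    Aι : ∀ n → Submodule (Λ.C n) (c ⊔ ℓ)
    Aι n = span {M = Λ.C n} {I = Σ[ x ∈ Vec V (suc n) ] StronglyRegular G x × Allowed G x}
                (λ (x , _) → FreeModule.gen (x , tt))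

    Ωι-submodule : ∀ n → Submodule (Λ.C n) (c ⊔ ℓ)
    Ωι-submodule zero    = Aι zero
    Ωι-submodule (suc n) = Aι (suc n) ∩ preimage (Λ.d n) (Aι n)

    Ωι : ChainComplex (c ⊔ ℓ) (c ⊔ ℓ)
    Ωι = subcomplex Λ Ωι-submodule closed
      where
      closed : ∀ n {v} → Submodule.Member (Ωι-submodule (suc n)) v →
               Submodule.Member (Ωι-submodule n) (Λ.∂ n v)
      closed zero    (_ , ∂v∈)     = ∂v∈
      closed (suc n) {v} (_ , ∂v∈) = ∂v∈ , resp (≈ᴹ-sym (Λ.∂∂≈0 n v)) 0∈
        where
        open Submodule (Aι n)
        open LeftModule (Λ.C n) using (≈ᴹ-sym)

    Inj : SemiSimplicialSet 0ℓ 0ℓ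
    Inj = deletion {P = λ x → Unique x × AllPairs (Reachable G) x}
            (λ i (u , r) → AllPairs-removeAt i u , AllPairs-removeAt i r)

{-# OPTIONS --safe #-}
module Submission where

-- Filter the chains of Inj(G) by the length of a word.  The end faces of a word strictly lower its
-- length, so the l-th graded piece is the Eulerian magnitude complex EMC_{*,l}.  Diagonality says that
-- a k-chain of length at most l > k whose boundary is shorter than l is a boundary of such chains modulo
-- chains of length less than l.  Descending on l, a k-chain whose boundary has the minimal length k - 1
-- is homologous to a chain of length k with the same boundary.  Words of k + 1 distinct letters and
-- length k are exactly the strongly regular allowed tuples, so Ω_k consists of the k-chains of length k
-- whose boundary has length k - 1.  Applied to cycles, the descent makes Ω → Inj(G) surjective on homology;
-- applied to a chain bounding an element of Ω, it makes it injective.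

open import Defs
open import Algebra.Bundles using (CommutativeMonoid; CommutativeRing)
import Algebra.Properties.AbelianGroup as AbelianGroupProperties
import Algebra.Properties.CommutativeMonoid.Sum as CommutativeMonoidSum
import Algebra.Properties.CommutativeSemigroup as CommutativeSemigroupProperties
open import Algebra.Module.Bundles using (LeftModule)
open import Data.Fin.Base using (Fin; zero; suc; toℕ; inject₁; fromℕ)
import Data.Fin.Properties as Fin
open import Data.Fin.Relation.Unary.Top using (view; ‵fromℕ; ‵inject₁)
open import Data.Nat.Base using (ℕ; zero; suc; _+_; _⊔_; _≤_; _<_; z≤n; s≤s; s≤s⁻¹)
import Data.Nat.Properties as ℕ
open import Data.Product.Base using (Σ-syntax; ∃-syntax; _×_; _,_; proj₁; proj₂)
open import Data.Sum.Base using (inj₁; inj₂)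
open import Data.Unit.Polymorphic.Base using (tt)
open import Data.Vec.Base using (Vec; _∷_; removeAt)
open import Data.Vec.Relation.Unary.All using ([]; _∷_)
open import Data.Vec.Relation.Unary.AllPairs using (AllPairs; []; _∷_; allPairs?)
open import Data.Vec.Relation.Unary.Linked using (Linked; []; [-]; _∷_)
open import Data.Vec.Relation.Unary.Linked.Properties using (Linked⇒All)
open import Data.Vec.Relation.Unary.Unique.Propositional using (Unique)
open import Function.Base using (_∘_; id)
open import Function.Properties.Inverse using (↔⇒↣)
open import Level using (Level)
open import Relation.Binary.Bundles using (Setoid)
open import Relation.Binary.Core using (Rel)
open import Relation.Binary.Definitions using (Transitive)
open import Relation.Binary.PropositionalEquality using (_≢_; refl; cong; subst)
import Relation.Binary.Reasoning.Setoid as SetoidReasoning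
open import Relation.Nullary.Decidable using (Dec; yes; no; ¬?; via-injection)
open import Relation.Nullary.Negation using (contradiction)

-- Lengths of words of distinct vertices.

Linked⇒AllPairs : ∀ {a r} {A : Set a} {R : Rel A r} → Transitive R →
                  ∀ {n} {xs : Vec A n} → Linked R xs → AllPairs R xs
Linked⇒AllPairs R-trans []        = []
Linked⇒AllPairs R-trans [-]       = [] ∷ []
Linked⇒AllPairs R-trans (r ∷ rs)  = Linked⇒All R-trans r rs ∷ Linked⇒AllPairs R-trans rs

module _ (G : FiniteDigraph) where
  open FiniteDigraph G

  Unique? : ∀ {n} (xs : Vec V n) → Dec (Unique xs)
  Unique? = allPairs? (λ x y → ¬? (via-injection (↔⇒↣ finite) Fin._≟_ x y))

  Reachable-trans : Transitive (Reachable G)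
  Reachable-trans (m , p) (n , q) = m + n , _++ᵖ_ G p q

  Length⇒Linked : ∀ {k l} {xs : Vec V (suc k)} → Length G xs l → Linked (Reachable G) xs
  Length⇒Linked [-]            = [-]
  Length⇒Linked ((p , _) ∷ ds) = (_ , p) ∷ Length⇒Linked ds

  Length⇒AllPairs : ∀ {k l} {xs : Vec V (suc k)} → Length G xs l → AllPairs (Reachable G) xs
  Length⇒AllPairs = Linked⇒AllPairs Reachable-trans ∘ Length⇒Linked

  AllPairs⇒Length : ∀ {k} {xs : Vec V (suc k)} → AllPairs (Reachable G) xs → ∃[ l ] Length G xs l
  AllPairs⇒Length ([] ∷ [])            = 0 , [-]
  AllPairs⇒Length (((_ , p) ∷ _) ∷ rs@(_ ∷ _)) =
    let (m , _ , d) = shortest-path G p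
        (l , ds)    = AllPairs⇒Length rs
    in m + l , d ∷ ds

  Distance-positive : ∀ {x y m} → x ≢ y → Distance G x y m → 0 < m
  Distance-positive {m = zero}  x≢y (ε , _) = contradiction refl x≢y
  Distance-positive {m = suc m} _   _       = s≤s z≤n

  -- Each of the `k` steps joins distinct vertices and so contributes at least 1. Equality forces
  -- every step to be an edge, which `Length⇒Allowed` exploits.
  Length-≥ : ∀ {k l} {xs : Vec V (suc k)} → Unique xs → Length G xs l → k ≤ l
  Length-≥ _                    [-]      = z≤n
  Length-≥ ((x≢y ∷ _) ∷ u) (d ∷ ds) = ℕ.+-mono-≤ (Distance-positive x≢y d) (Length-≥ u ds)

  Allowed⇒Length : ∀ {k} {xs : Vec V (suc k)} → Unique xs → Allowed G xs → Length G xs k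
  Allowed⇒Length                _               [-]              = [-]
  Allowed⇒Length {xs = x ∷ y ∷ _} ((x≢y ∷ _) ∷ u) (e ∷ es) =
    (e ◅ ε , λ { {zero} ε → contradiction refl x≢y ; {suc _} _ → s≤s z≤n }) ∷ Allowed⇒Length u es

  Length⇒Allowed : ∀ {k} {xs : Vec V (suc k)} → Unique xs → Length G xs k → Allowed G xs
  Length⇒Allowed u ds = go u ds ℕ.≤-refl
    where
    -- A bound replaces the equation because the index `m + l` does not unify with `suc k`. A first
    -- step of 2 or more would leave less than `Length-≥` demands of the rest.
    go : ∀ {k l} {xs : Vec V (suc k)} → Unique xs → Length G xs l → l ≤ k → Allowed G xs
    go _ [-] _ = [-]
    go ((x≢y ∷ _) ∷ u) (_∷_ {m = zero}        d             ds) _   = contradiction (Distance-positive x≢y d) λ ()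
    go (_ ∷ u)         (_∷_ {m = suc zero}    (e ◅ ε , _)   ds) l≤k = e ∷ go u ds (s≤s⁻¹ l≤k)
    go {k = suc k} (_ ∷ u) (_∷_ {m = suc (suc m)} {l = l} _ ds) l≤k =
      contradiction (ℕ.≤-trans (ℕ.+-monoʳ-≤ (suc m) (Length-≥ u ds)) (s≤s⁻¹ l≤k)) (ℕ.<⇒≱ (s≤s (ℕ.m≤n+m k m)))

  Length-minimal : ∀ {k l} {xs : Vec V (suc k)} → Unique xs → l < suc k → Length G xs l → Length G xs k
  Length-minimal u l<1+k ds = subst (Length G _) (ℕ.≤-antisym (s≤s⁻¹ l<1+k) (Length-≥ u ds)) ds

  -- Dropping an end letter loses one whole step, which is positive. The strictness is what later
  -- removes the end faces from the graded boundary.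
  Length-removeAt-first : ∀ {k l} {xs : Vec V (suc (suc k))} → Unique xs → Length G xs l →
                          ∃[ l′ ] l′ < l × Length G (removeAt xs zero) l′
  Length-removeAt-first ((x≢y ∷ _) ∷ _) (d ∷ ds) =
    _ , ℕ.+-monoˡ-≤ _ (Distance-positive x≢y d) , ds

  Length-removeAt-last : ∀ {k l} {xs : Vec V (suc (suc k))} → Unique xs → Length G xs l →
                         ∃[ l′ ] l′ < l × Length G (removeAt xs (fromℕ (suc k))) l′
  Length-removeAt-last ((x≢y ∷ _) ∷ _) (d ∷ [-]) =
    0 , ℕ.≤-trans (Distance-positive x≢y d) (ℕ.m≤m+n _ 0) , [-]
  Length-removeAt-last (_ ∷ u) (_∷_ {m = m} d ds@(_ ∷ _)) =
    let (l′ , l′<l , ds′) = Length-removeAt-last u ds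
    in m + l′ , ℕ.+-monoʳ-< m l′<l , prepend d ds ds′
    where
    -- Exposing the head of `xs` lets `removeAt` compute, so that `y` visibly survives as the second
    -- letter.
    prepend : ∀ {k x y m l l′} {xs : Vec V (suc k)} → Distance G x y m → Length G (y ∷ xs) l →
              Length G (removeAt (y ∷ xs) (fromℕ (suc k))) l′ →
              Length G (removeAt (x ∷ y ∷ xs) (fromℕ (suc (suc k)))) (m + l′)
    prepend {xs = _ ∷ _} d _ ds′ = d ∷ ds′

  Length-face : ∀ {k l} {xs : Vec V (suc (suc k))} (i : Fin (suc (suc k))) → Unique xs → Length G xs l →
                ∃[ l′ ] l′ ≤ l × Length G (removeAt xs i) l′
  Length-face zero u ds = let (l′ , l′<l , ds′) = Length-removeAt-first u ds in l′ , ℕ.<⇒≤ l′<l , ds′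
  Length-face (suc i) u ds with view i
  ... | ‵fromℕ     = let (l′ , l′<l , ds′) = Length-removeAt-last u ds in l′ , ℕ.<⇒≤ l′<l , ds′
  ... | ‵inject₁ j = Length-removeAt G j ds

-- Linear maps on spans and signed sums.

module LinearAlgebra {c ℓ : Level} (R : CommutativeRing c ℓ) where
  open OverRing R

  module _ {m ℓm p : Level} {M : RModule m ℓm} (P : Submodule M p)
           {i : Level} {I : Set i} {b : I → LeftModule.Carrierᴹ M} where
    open Submodule P

    -- The way to argue about spans below: phrase the claim as membership in a submodule, often a
    -- preimage or a kernel, and check it on generators.
    span-⊆ : (∀ j → Member (b j)) → ∀ {v} → InSpan {M = M} b v → Member v
    span-⊆ b∈ (gen-∈ j)      = b∈ j
    span-⊆ b∈ (resp-∈ x≈y x∈) = resp x≈y (span-⊆ b∈ x∈)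
    span-⊆ b∈ 0-∈            = 0∈
    span-⊆ b∈ (+-∈ x∈ y∈)    = +∈ (span-⊆ b∈ x∈) (span-⊆ b∈ y∈)
    span-⊆ b∈ (*-∈ r x∈)     = *∈ r (span-⊆ b∈ x∈)

  module _ {m ℓm : Level} {M : RModule m ℓm} where
    open LeftModule M
    open AbelianGroupProperties +ᴹ-abelianGroup using (⁻¹-∙-comm; ε⁻¹≈ε; x∙y⁻¹≈ε⇒x≈y)
    open CommutativeSemigroupProperties (CommutativeMonoid.commutativeSemigroup +ᴹ-commutativeMonoid)
      using (interchange)

    -‿interchange : ∀ x y u v → (x +ᴹ u) +ᴹ (-ᴹ (y +ᴹ v)) ≈ᴹ (x +ᴹ (-ᴹ y)) +ᴹ (u +ᴹ (-ᴹ v))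
    -‿interchange x y u v = ≈ᴹ-trans (+ᴹ-congˡ (≈ᴹ-sym (⁻¹-∙-comm y v))) (interchange x u (-ᴹ y) (-ᴹ v))

    *ₗ-distribˡ-- : ∀ r x y → r *ₗ (x +ᴹ (-ᴹ y)) ≈ᴹ r *ₗ x +ᴹ (-ᴹ (r *ₗ y))
    *ₗ-distribˡ-- r x y = ≈ᴹ-trans (*ₗ-distribˡ r x (-ᴹ y)) (+ᴹ-congˡ (*ₗ-neg {M = M} r y))

    x-0≈x : ∀ x {y} → y ≈ᴹ 0ᴹ → x +ᴹ (-ᴹ y) ≈ᴹ x
    x-0≈x x y≈0 = ≈ᴹ-trans (+ᴹ-congˡ (≈ᴹ-trans (-ᴹ‿cong y≈0) ε⁻¹≈ε)) (+ᴹ-identityʳ x)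

    x≈y⇒x-y≈0 : ∀ {x y} → x ≈ᴹ y → x +ᴹ (-ᴹ y) ≈ᴹ 0ᴹ
    x≈y⇒x-y≈0 x≈y = ≈ᴹ-trans (+ᴹ-congʳ x≈y) (-ᴹ‿inverseʳ _)

    x-y≈0⇒x≈y : ∀ {x y} → x +ᴹ (-ᴹ y) ≈ᴹ 0ᴹ → x ≈ᴹ y
    x-y≈0⇒x≈y = x∙y⁻¹≈ε⇒x≈y _ _

    0-submodule : Submodule M ℓm
    0-submodule = record
      { Member = _≈ᴹ 0ᴹ
      ; resp   = λ x≈y x≈0 → ≈ᴹ-trans (≈ᴹ-sym x≈y) x≈0
      ; 0∈     = ≈ᴹ-refl
      ; +∈     = λ x≈0 y≈0 → ≈ᴹ-trans (+ᴹ-cong x≈0 y≈0) (+ᴹ-identityˡ 0ᴹ)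
      ; *∈     = λ r x≈0 → ≈ᴹ-trans (*ₗ-congˡ x≈0) (*ₗ-zeroʳ r)
      }

  identityMap : {m ℓm : Level} (M : RModule m ℓm) → LinearMap M M
  identityMap M = linearMap {M = M} {N = M} id id (λ _ _ → ≈ᴹ-refl) (λ _ _ → ≈ᴹ-refl)
    where open LeftModule M

  module _ {m ℓm n ℓn : Level} {M : RModule m ℓm} {N : RModule n ℓn} where
    private
      module M = LeftModule M
      module N = LeftModule N
    open LinearMap

    difference : LinearMap M N → LinearMap M N → LinearMap M N
    difference f g = linearMap {M = M} {N = N}
      (λ v → ⟦ f ⟧ v N.+ᴹ (N.-ᴹ ⟦ g ⟧ v))
      (λ x≈y → N.+ᴹ-cong (⟦⟧-cong f x≈y) (N.-ᴹ‿cong (⟦⟧-cong g x≈y)))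
      (λ x y → N.≈ᴹ-trans (N.+ᴹ-cong (+ᴹ-homo f x y) (N.-ᴹ‿cong (+ᴹ-homo g x y)))
                 (-‿interchange {M = N} _ _ _ _))
      (λ r x → N.≈ᴹ-trans (N.+ᴹ-cong (*ₗ-homo f r x) (N.-ᴹ‿cong (*ₗ-homo g r x)))
                 (N.≈ᴹ-sym (*ₗ-distribˡ-- {M = N} r _ _)))

    -‿homo : (f : LinearMap M N) → ∀ x y →
             ⟦ f ⟧ (x M.+ᴹ (M.-ᴹ y)) N.≈ᴹ ⟦ f ⟧ x N.+ᴹ (N.-ᴹ ⟦ f ⟧ y)
    -‿homo f x y = N.≈ᴹ-trans (+ᴹ-homo f x (M.-ᴹ y)) (N.+ᴹ-congˡ (-ᴹ-homo f y))

    -- The elements where `f` and `g` agree form the kernel of their difference.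
    span-≈ : (f g : LinearMap M N) {i : Level} {I : Set i} {b : I → M.Carrierᴹ} →
             (∀ j → ⟦ f ⟧ (b j) N.≈ᴹ ⟦ g ⟧ (b j)) → ∀ {v} → InSpan {M = M} b v → ⟦ f ⟧ v N.≈ᴹ ⟦ g ⟧ v
    span-≈ f g f≈g v∈ = x-y≈0⇒x≈y {M = N}
      (span-⊆ (kernel {M = M} {N = N} (difference f g)) (λ j → x≈y⇒x-y≈0 {M = N} (f≈g j)) v∈)

    signedSum-∈ : ∀ {p} (P : Submodule N p) {k} (s : Fin k → ℕ) (f : Fin k → LinearMap M N) v →
                  (∀ i → Submodule.Member P (⟦ f i ⟧ v)) →
                  Submodule.Member P (⟦ signedSum {M = M} {N = N} s f ⟧ v)
    signedSum-∈ P {zero}  s f v f∈ = Submodule.0∈ P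
    signedSum-∈ P {suc k} s f v f∈ = Submodule.+∈ P (Submodule.*∈ P _ (f∈ zero))
      (signedSum-∈ P (s ∘ suc) (f ∘ suc) v (f∈ ∘ suc))

  module _ {a ℓa b ℓb m ℓm n ℓn : Level}
           {A : RModule a ℓa} {B : RModule b ℓb} {M : RModule m ℓm} {N : RModule n ℓn} where
    private
      module B = LeftModule B
      module N = LeftModule N
    open LinearMap

    -- The terms are compared at one pair `v`, `w` only, so no map between `A` and `M` is required;
    -- `πι-∂` needs this, as its faces match only on words of full length.
    signedSum-natural : ∀ {k} (s : Fin k → ℕ) (f : Fin k → LinearMap A B) (g : Fin k → LinearMap M N)
                        (h : LinearMap B N) v w → (∀ i → ⟦ h ⟧ (⟦ f i ⟧ v) N.≈ᴹ ⟦ g i ⟧ w) →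
                        ⟦ h ⟧ (⟦ signedSum {M = A} {N = B} s f ⟧ v) N.≈ᴹ
                        ⟦ signedSum {M = M} {N = N} s g ⟧ w
    signedSum-natural {zero}  s f g h v w h≈ = 0ᴹ-homo h
    signedSum-natural {suc k} s f g h v w h≈ = N.≈ᴹ-trans (+ᴹ-homo h _ _)
      (N.+ᴹ-cong (N.≈ᴹ-trans (*ₗ-homo h _ _) (N.*ₗ-congˡ (h≈ zero)))
                 (signedSum-natural (s ∘ suc) (f ∘ suc) (g ∘ suc) h v w (h≈ ∘ suc)))

  module _ {m ℓm n ℓn : Level} {M : RModule m ℓm} {N : RModule n ℓn} where
    open LeftModule N
    open LinearMap
    open CommutativeMonoidSum +ᴹ-commutativeMonoid using (sum; sum-init-last)
    open SetoidReasoning ≈ᴹ-setoid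

    signedSum-interior : ∀ {k} (f : Fin (suc (suc k)) → LinearMap M N) {v} →
                         ⟦ f zero ⟧ v ≈ᴹ 0ᴹ → ⟦ f (fromℕ (suc k)) ⟧ v ≈ᴹ 0ᴹ →
                         ⟦ signedSum {M = M} {N = N} toℕ f ⟧ v ≈ᴹ
                         ⟦ signedSum {M = M} {N = N} (λ i → toℕ (suc (inject₁ i)))
                                                     (λ i → f (suc (inject₁ i))) ⟧ v
    signedSum-interior {k} f {v} first≈0 last≈0 = begin
      t zero +ᴹ sum (t ∘ suc)
        ≈⟨ +ᴹ-cong (vanish {zero} first≈0) (sum-init-last (t ∘ suc)) ⟩
      0ᴹ +ᴹ (sum (λ i → t (suc (inject₁ i))) +ᴹ t (suc (fromℕ k)))
        ≈⟨ +ᴹ-identityˡ _ ⟩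
      sum (λ i → t (suc (inject₁ i))) +ᴹ t (suc (fromℕ k))
        ≈⟨ +ᴹ-congˡ (vanish {suc (fromℕ k)} last≈0) ⟩
      sum (λ i → t (suc (inject₁ i))) +ᴹ 0ᴹ
        ≈⟨ +ᴹ-identityʳ _ ⟩
      sum (λ i → t (suc (inject₁ i))) ∎
      where
      t : Fin (suc (suc k)) → Carrierᴹ
      t i = sign (toℕ i) *ₗ ⟦ f i ⟧ v

      vanish : ∀ {i} → ⟦ f i ⟧ v ≈ᴹ 0ᴹ → t i ≈ᴹ 0ᴹ
      vanish fi≈0 = ≈ᴹ-trans (*ₗ-congˡ fi≈0) (*ₗ-zeroʳ _)

  -- A criterion for a chain map to be an isomorphism on homology.

  module _ {k ℓk l ℓl : Level} (K : ChainComplex k ℓk) (L : ChainComplex l ℓl) where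
    private
      module K = ChainComplex K
      module L = ChainComplex L
      module KC n = LeftModule (K.C n)
      module LC n = LeftModule (L.C n)
    open LinearMap

    -- `f-reflects-∂` yields injectivity on homology. The surjectivity hypotheses do not ask that
    -- `x` be a cycle; `f-reflects-0` supplies that. Degree 0 is separate because no differential
    -- leaves it.
    module _ (f : ∀ n → LinearMap (K.C n) (L.C n))
             (f-∂ : ∀ n x → LC._≈ᴹ_ n (⟦ f n ⟧ (K.∂ n x)) (L.∂ n (⟦ f (suc n) ⟧ x)))
             (f-reflects-∂ : ∀ n x u → LC._≈ᴹ_ n (L.∂ n u) (⟦ f n ⟧ x) →
                             ∃[ w ] KC._≈ᴹ_ n (K.∂ n w) x)
             (f-reflects-0 : ∀ n x → LC._≈ᴹ_ n (⟦ f n ⟧ x) (LC.0ᴹ n) → KC._≈ᴹ_ n x (KC.0ᴹ n))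
             (f-surjective₀ : ∀ y → ∃[ x ] ∃[ u ] LC._≈ᴹ_ 0 (L.∂ 0 u)
                                              (LC._+ᴹ_ 0 (⟦ f 0 ⟧ x) (LC.-ᴹ_ 0 y)))
             (f-surjective₊ : ∀ n y → LC._≈ᴹ_ n (L.∂ n y) (LC.0ᴹ n) →
                              ∃[ x ] ∃[ u ] LC._≈ᴹ_ (suc n) (L.∂ (suc n) u)
                                              (LC._+ᴹ_ (suc n) (⟦ f (suc n) ⟧ x) (LC.-ᴹ_ (suc n) y)))
             where

      f-cycle : ∀ n x → Submodule.Member (cycles K n) x → Submodule.Member (cycles L n) (⟦ f n ⟧ x)
      f-cycle zero    x _    = tt
      f-cycle (suc n) x ∂x≈0 = LC.≈ᴹ-trans n (LC.≈ᴹ-sym n (f-∂ n x))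
        (LC.≈ᴹ-trans n (⟦⟧-cong (f n) ∂x≈0) (0ᴹ-homo (f n)))

      homologyMap : ∀ n → LinearMap (H K n) (H L n)
      homologyMap n = linearMap {M = H K n} {N = H L n}
        (λ (x , z) → ⟦ f n ⟧ x , f-cycle n x z)
        (λ { {x , _} {y , _} (w , ∂w≈x-y) → ⟦ f (suc n) ⟧ w ,
             LC.≈ᴹ-trans n (LC.≈ᴹ-sym n (f-∂ n w)) (LC.≈ᴹ-trans n (⟦⟧-cong (f n) ∂w≈x-y)
               (-‿homo {M = K.C n} {N = L.C n} (f n) x y)) })
        (λ (x , _) (y , _) → 0-boundary (+ᴹ-homo (f n) x y))
        (λ r (x , _) → 0-boundary (*ₗ-homo (f n) r x))
        where
        0-boundary : ∀ {x y} → LC._≈ᴹ_ n x y →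
                     Submodule.Member (boundaries L n) (LC._+ᴹ_ n x (LC.-ᴹ_ n y))
        0-boundary x≈y = LC.0ᴹ (suc n) ,
          LC.≈ᴹ-trans n (0ᴹ-homo (L.d n)) (LC.≈ᴹ-sym n (x≈y⇒x-y≈0 {M = L.C n} x≈y))

      -- The image of `x` differs from the cycle `y` by a boundary, so it is a cycle, and
      -- injectivity of `f` on chains carries this back to `x`.
      f-surjective : ∀ n y → Submodule.Member (cycles L n) y →
                     ∃[ x ] Submodule.Member (cycles K n) x ×
                     ∃[ u ] LC._≈ᴹ_ n (L.∂ n u) (LC._+ᴹ_ n (⟦ f n ⟧ x) (LC.-ᴹ_ n y))
      f-surjective zero    y _    = let (x , u , ∂u≈) = f-surjective₀ y in x , tt , u , ∂u≈
      f-surjective (suc n) y ∂y≈0 = let (x , u , ∂u≈) = f-surjective₊ n y ∂y≈0 in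
        x , f-reflects-0 n (K.∂ n x) (≈ᴹ-trans (f-∂ n x) (≈ᴹ-trans (x-y≈0⇒x≈y {M = L.C n} (begin
          L.∂ n (⟦ f (suc n) ⟧ x) +ᴹ (-ᴹ L.∂ n y)
            ≈⟨ -‿homo {M = L.C (suc n)} {N = L.C n} (L.d n) _ _ ⟨
          L.∂ n (LC._+ᴹ_ (suc n) (⟦ f (suc n) ⟧ x) (LC.-ᴹ_ (suc n) y))
            ≈⟨ ⟦⟧-cong (L.d n) ∂u≈ ⟨
          L.∂ n (L.∂ (suc n) u)
            ≈⟨ L.∂∂≈0 n u ⟩
          0ᴹ ∎)) ∂y≈0)) , u , ∂u≈
        where
        open LeftModule (L.C n)
        open SetoidReasoning ≈ᴹ-setoid

      homology-≅ : ∀ n → H K n ≅ H L n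
      homology-≅ n = ⟦ homologyMap n ⟧ , record
        { isLeftModuleMonomorphism = record
          { isLeftModuleHomomorphism = isLeftModuleHomomorphism (homologyMap n)
          ; injective = λ { {x , _} {y , _} (u , ∂u≈fx-fy) → f-reflects-∂ n _ u
              (LC.≈ᴹ-trans n ∂u≈fx-fy (LC.≈ᴹ-sym n (-‿homo {M = K.C n} {N = L.C n} (f n) x y))) }
          }
        ; surjective = λ (y , z) → let (x , z′ , ∂u≈fx-y) = f-surjective n y z in
            (x , z′) , λ {x′} x′≈x → LeftModule.≈ᴹ-trans (H L n)
              {⟦ homologyMap n ⟧ x′} {⟦ homologyMap n ⟧ (x , z′)} {y , z}
              (⟦⟧-cong (homologyMap n) {x′} {x , z′} x′≈x) ∂u≈fx-y
        }

-- Maps between injective words, all tuples and magnitude chains.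

module Comparison {c ℓ : Level} (R : CommutativeRing c ℓ) (G : FiniteDigraph) where
  open FiniteDigraph G
  open OverRing R
  open LinearAlgebra R
  open LinearMap
  open FreeModule using (gen; 𝟎; _⊕_; -_; _·_; ≋-refl; ≋-sym; ≋-trans)

  module Λ = ChainComplex (Λ G)
  module I = ChainComplex (chains (Inj G))
  module EMC (l : ℕ) = ChainComplex (EMC G l)

  Word : ℕ → Set
  Word k = Setoid.Carrier (SemiSimplicialSet.Simplex (Inj G) k)

  infix 4 _≈Λ_ _≈I_

  _≈Λ_ : ∀ {k} → Rel (LeftModule.Carrierᴹ (Λ.C k)) _
  _≈Λ_ {k} = LeftModule._≈ᴹ_ (Λ.C k)

  _≈I_ : ∀ {k} → Rel (LeftModule.Carrierᴹ (I.C k)) _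
  _≈I_ {k} = LeftModule._≈ᴹ_ (I.C k)

  ι : ∀ k → LinearMap (I.C k) (Λ.C k)
  ι k = FreeModule.extend _ {M = Λ.C k} (record
    { to   = λ (x , _) → gen (x , tt)
    ; cong = FreeModule.gen-cong
    })

  ι-∂ : ∀ k v → ⟦ ι k ⟧ (I.∂ k v) ≈Λ Λ.∂ k (⟦ ι (suc k) ⟧ v)
  ι-∂ k v = signedSum-natural {A = I.C (suc k)} {B = I.C k} {M = Λ.C (suc k)} {N = Λ.C k}
    toℕ (faceMap (Inj G) k) (faceMap (AllTuples G) k) (ι k) v (⟦ ι (suc k) ⟧ v)
    (λ i → FreeModule.extensionality _ {M = Λ.C k}
      (compose {M = I.C (suc k)} {N = I.C k} {P = Λ.C k} (faceMap (Inj G) k i) (ι k))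
      (compose {M = I.C (suc k)} {N = Λ.C (suc k)} {P = Λ.C k} (ι (suc k)) (faceMap (AllTuples G) k i))
      (λ _ → ≋-refl) v)

  module _ (l : ℕ) where

    _≈E_ : ∀ {k} → Rel (LeftModule.Carrierᴹ (EMC.C l k)) _
    _≈E_ {k} = LeftModule._≈ᴹ_ (EMC.C l k)

    tupleOr0 : ∀ {k} (x : Vec V (suc k)) → Dec (Unique x) → LeftModule.Carrierᴹ (EMC.C l k)
    tupleOr0 x (yes u) = genOr0 G l x u (Length? G x l)
    tupleOr0 x (no _)  = 𝟎

    -- Defined on all tuples, so that it serves both `πι` and `ρ`. It tests only distinctness and
    -- length, which are decidable, and never reachability.
    π : ∀ k → LinearMap (Λ.C k) (EMC.C l k)
    π k = FreeModule.extend _ {M = EMC.C l k} (record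
      { to   = λ (x , _) → tupleOr0 x (Unique? G x)
      ; cong = λ x≡y → Setoid.reflexive (LeftModule.≈ᴹ-setoid (EMC.C l k))
                 (cong (λ x → tupleOr0 x (Unique? G x)) x≡y)
      })

    -- The decision `d` is arbitrary, so that a caller can supply `yes` or `no` and have the right
    -- side compute.
    π-gen : ∀ {k} {x : Vec V (suc k)} (u : Unique x) (d : Dec (Length G x l)) →
            ⟦ π k ⟧ (gen (x , tt)) ≈E genOr0 G l x u d
    π-gen {x = x} u d with Unique? G x
    ... | yes _ = genOr0-cong G l (Length? G x l) d refl
    ... | no ¬u = contradiction u ¬u

    π-gen-≢ : ∀ {k l′} {x : Vec V (suc k)} → Unique x → Length G x l′ → l′ ≢ l →
              ⟦ π k ⟧ (gen (x , tt)) ≈E 𝟎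
    π-gen-≢ u ds l′≢l = π-gen u (no (l′≢l ∘ Length-unique G ds))

    -- A linear section of `πι`, in general not a chain map: the boundary in `Inj` also contains the
    -- shorter faces.
    σ : ∀ k → LinearMap (EMC.C l k) (I.C k)
    σ k = FreeModule.extend _ {M = I.C k} (record
      { to   = λ (x , u , ds) → gen (x , u , Length⇒AllPairs G ds)
      ; cong = FreeModule.gen-cong
      })

    πι : ∀ k → LinearMap (I.C k) (EMC.C l k)
    πι k = compose {M = I.C k} {N = Λ.C k} {P = EMC.C l k} (ι k) (π k)

    πι-σ : ∀ k w → ⟦ πι k ⟧ (⟦ σ k ⟧ w) ≈E w
    πι-σ k = FreeModule.extensionality _ {M = EMC.C l k}
      (compose {M = EMC.C l k} {N = I.C k} {P = EMC.C l k} (σ k) (πι k)) (identityMap (EMC.C l k))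
      (λ (x , u , ds) → π-gen u (yes ds))

  -- The length filtration and its graded pieces.

  -- Strict inequality, so that Short 0 k is trivial and Short (suc k) k is spanned by the words all of
  -- whose steps are edges.
  module _ (n k : ℕ) where
    ShortWord : Set
    ShortWord = Σ[ x ∈ Word k ] ∃[ l ] l < n × Length G (proj₁ x) l

    Short : Submodule (I.C k) _
    Short = span {M = I.C k} {I = ShortWord} (gen ∘ proj₁)

    open Submodule Short public using () renaming (Member to IsShort)

  private module Short {n} {k} = Submodule (Short n k)

  σ-short : ∀ {k l} w → IsShort (suc l) k (⟦ σ l k ⟧ w)
  σ-short     (gen (x , u , ds)) = gen-∈ ((x , u , _) , _ , ℕ.≤-refl , ds)
  σ-short     𝟎                  = Short.0∈
  σ-short     (v ⊕ w)            = Short.+∈ (σ-short v) (σ-short w)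
  σ-short {k} (- w)              = -∈ {M = I.C k} (Short _ k) (σ-short w)
  σ-short     (r · w)            = Short.*∈ r (σ-short w)

  short-mono : ∀ {k m n} → m ≤ n → ∀ {v} → IsShort m k v → IsShort n k v
  short-mono {k} m≤n = span-⊆ {M = I.C k} (Short _ k)
    (λ (x , l , l<m , ds) → gen-∈ (x , l , ℕ.≤-trans l<m m≤n , ds))

  -- The filtration is exhaustive: a chain is a finite expression, so the lengths of its words have
  -- a maximum.
  every-short : ∀ {k} v → ∃[ n ] IsShort n k v
  every-short     (gen x@(_ , _ , rs)) = let (l , ds) = AllPairs⇒Length G rs in
    suc l , gen-∈ (x , l , ℕ.≤-refl , ds)
  every-short     𝟎       = 0 , 0-∈
  every-short     (v ⊕ w) = let (m , v∈) = every-short v ; (n , w∈) = every-short w in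
    m ⊔ n , +-∈ (short-mono (ℕ.m≤m⊔n m n) v∈) (short-mono (ℕ.m≤n⊔m m n) w∈)
  every-short {k} (- v)   = let (n , v∈) = every-short v in n , -∈ {M = I.C k} (Short n k) v∈
  every-short     (r · v) = let (n , v∈) = every-short v in n , *-∈ r v∈

  -- No face is longer than its word: an end face drops a step, and an interior face obeys the
  -- triangle inequality.
  ∂-short : ∀ {k n v} → IsShort n (suc k) v → IsShort n k (I.∂ k v)
  ∂-short {k} {n} = span-⊆ {M = I.C (suc k)}
    (preimage {M = I.C (suc k)} {N = I.C k} (I.d k) (Short n k))
    (λ { (x@(_ , u , _) , l , l<n , ds) →
         signedSum-∈ {M = I.C (suc k)} {N = I.C k} (Short n k) toℕ (faceMap (Inj G) k) (gen x) (λ i →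
           let (l′ , l′≤l , ds′) = Length-face G i u ds
           in gen-∈ (_ , l′ , ℕ.≤-<-trans l′≤l l<n , ds′)) })

  πι-short : ∀ {k l v} → IsShort l k v → _≈E_ l (⟦ πι l k ⟧ v) 𝟎
  πι-short {k} {l} = span-⊆ {M = I.C k} (kernel {M = I.C k} {N = EMC.C l k} (πι l k))
    (λ { ((_ , u , _) , l′ , l′<l , ds) → π-gen-≢ l u ds (ℕ.<⇒≢ l′<l) })

  -- Subtracting `σ (πι v)` from `v` fixes words shorter than `l` and cancels those of length `l`,
  -- so the result is short; when `πι v` vanishes, nothing was subtracted.
  short-πι : ∀ {k l v} → IsShort (suc l) k v → _≈E_ l (⟦ πι l k ⟧ v) 𝟎 → IsShort l k v
  short-πι {k} {l} {v} v∈ πv≈0 = Short.resp (x-0≈x {M = I.C k} v (⟦⟧-cong (σ l k) πv≈0))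
    (span-⊆ {M = I.C k} (preimage {M = I.C k} {N = I.C k} residual (Short l k)) residual-gen v∈)
    where
    σπι : LinearMap (I.C k) (I.C k)
    σπι = compose {M = I.C k} {N = EMC.C l k} {P = I.C k} (πι l k) (σ l k)

    residual : LinearMap (I.C k) (I.C k)
    residual = difference {M = I.C k} {N = I.C k} (identityMap (I.C k)) σπι

    residual-gen : ∀ x → IsShort l k (⟦ residual ⟧ (gen (proj₁ x)))
    residual-gen (x@(_ , u , _) , l′ , l′<1+l , ds) with ℕ.m≤n⇒m<n∨m≡n (s≤s⁻¹ l′<1+l)
    ... | inj₁ l′<l = Short.resp
      (≋-sym (x-0≈x {M = I.C k} (gen x) (⟦⟧-cong (σ l k) (π-gen-≢ l u ds (ℕ.<⇒≢ l′<l)))))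
      (gen-∈ (x , l′ , l′<l , ds))
    ... | inj₂ refl = Short.resp
      (≋-sym (x≈y⇒x-y≈0 {M = I.C k} (≋-sym
        (≋-trans (⟦⟧-cong (σ l k) (π-gen l u (yes ds))) (FreeModule.gen-cong refl)))))
      Short.0∈

  -- On a word shorter than `l` both sides vanish. On a word of length `l` the end faces are shorter
  -- and die under `π`, and the interior faces become those of the magnitude complex.
  πι-∂ : ∀ {k l v} → IsShort (suc l) (suc k) v →
         _≈E_ l (⟦ πι l k ⟧ (I.∂ k v)) (EMC.∂ l k (⟦ πι l (suc k) ⟧ v))
  πι-∂ {k} {l} = span-≈ {M = I.C (suc k)} {N = EMC.C l k}
    (compose {M = I.C (suc k)} {N = I.C k} {P = EMC.C l k} (I.d k) (πι l k))
    (compose {M = I.C (suc k)} {N = EMC.C l (suc k)} {P = EMC.C l k} (πι l (suc k)) (EMC.d l k))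
    agree
    where
    πface : Fin (suc (suc k)) → LinearMap (I.C (suc k)) (EMC.C l k)
    πface i = compose {M = I.C (suc k)} {N = I.C k} {P = EMC.C l k} (faceMap (Inj G) k i) (πι l k)

    π∂≈ : ∀ v → _≈E_ l (⟦ πι l k ⟧ (I.∂ k v))
                       (⟦ signedSum {M = I.C (suc k)} {N = EMC.C l k} toℕ πface ⟧ v)
    π∂≈ v = signedSum-natural {A = I.C (suc k)} {B = I.C k} {M = I.C (suc k)} {N = EMC.C l k}
      toℕ (faceMap (Inj G) k) πface (πι l k) v v (λ _ → ≋-refl)

    agree : ∀ x → _≈E_ l (⟦ πι l k ⟧ (I.∂ k (gen (proj₁ x))))
                         (EMC.∂ l k (⟦ πι l (suc k) ⟧ (gen (proj₁ x))))
    agree (x@(xs , u , _) , l′ , l′<1+l , ds) with ℕ.m≤n⇒m<n∨m≡n (s≤s⁻¹ l′<1+l)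
    ... | inj₁ l′<l = ≋-trans
      (πι-short (∂-short (gen-∈ (x , l′ , l′<l , ds))))
      (≋-sym (≋-trans (⟦⟧-cong (EMC.d l k) (π-gen-≢ l u ds (ℕ.<⇒≢ l′<l))) (0ᴹ-homo (EMC.d l k))))
    ... | inj₂ refl = ≋-trans (π∂≈ (gen x)) (≋-trans
      (signedSum-interior {M = I.C (suc k)} {N = EMC.C l k} πface {gen x}
        (strict zero (Length-removeAt-first G u ds))
        (strict (fromℕ (suc k)) (Length-removeAt-last G u ds)))
      (≋-trans
        -- With the identity as `h`, this compares the two signed sums term by term.
        (signedSum-natural {A = I.C (suc k)} {B = EMC.C l k} {M = EMC.C l (suc k)} {N = EMC.C l k}
          (toℕ ∘ interior G) (πface ∘ interior G) (deleteOr0 G l k ∘ interior G)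
          (identityMap (EMC.C l k)) (gen x) (gen (xs , u , ds))
          (λ i → π-gen l (AllPairs-removeAt (interior G i) u) (Length? G (removeAt xs (interior G i)) l)))
        (⟦⟧-cong (EMC.d l k) (≋-sym (π-gen l u (yes ds))))))
      where
      strict : ∀ i → ∃[ l″ ] l″ < l × Length G (removeAt xs i) l″ → _≈E_ l (⟦ πface i ⟧ (gen x)) 𝟎
      strict i (l″ , l″<l , ds″) = π-gen-≢ l (AllPairs-removeAt i u) ds″ (ℕ.<⇒≢ l″<l)

  -- Descent along the filtration.

  -- Reachability is not decided, so ι has no evident retraction; but all π l vanish on the kernel of ι,
  -- which pushes its elements down the filtration to 0.
  ι-injective : ∀ {k x y} → ⟦ ι k ⟧ x ≈Λ ⟦ ι k ⟧ y → x ≈I y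
  ι-injective {k} {x} {y} ιx≈ιy = x-y≈0⇒x≈y {M = I.C k}
    (vanish _ (proj₂ (every-short (x ⊕ (- y)))) (λ l →
      ≋-trans (⟦⟧-cong (π l k) (≋-trans (-‿homo {M = I.C k} {N = Λ.C k} (ι k) x y)
                                        (x≈y⇒x-y≈0 {M = Λ.C k} ιx≈ιy)))
              (0ᴹ-homo (π l k))))
    where
    vanish : ∀ n {v} → IsShort n k v → (∀ l → _≈E_ l (⟦ πι l k ⟧ v) 𝟎) → v ≈I 𝟎
    vanish zero    v∈ _    = span-⊆ {M = I.C k} (0-submodule {M = I.C k}) (λ { (_ , _ , () , _) }) v∈
    vanish (suc n) v∈ πv≈0 = vanish n (short-πι v∈ (πv≈0 n)) πv≈0

  -- The counterpart in `Inj` of the boundary condition defining Ω. Cycles satisfy it, and so do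
  -- chains bounding an element of Ω, so one descent treats both.
  LowBoundary : ∀ k → Submodule (I.C k) (c Level.⊔ ℓ)
  LowBoundary zero    = whole _
  LowBoundary (suc k) = preimage {M = I.C (suc k)} {N = I.C k} (I.d k) (Short (suc k) k)

  HasLowBoundary : ∀ k → LeftModule.Carrierᴹ (I.C k) → Set _
  HasLowBoundary k = Submodule.Member (LowBoundary k)

  lowBoundary-∂ : ∀ k u → HasLowBoundary k (I.∂ k u)
  lowBoundary-∂ zero    u = tt
  lowBoundary-∂ (suc k) u = Short.resp (≋-sym (I.∂∂≈0 k u)) Short.0∈

  private
    -‿∈ : ∀ {p k} (P : Submodule (I.C k) p) {x y} → Submodule.Member P x → Submodule.Member P y →
          Submodule.Member P (x ⊕ (- y))
    -‿∈ {k = k} P x∈ y∈ = Submodule.+∈ P x∈ (-∈ {M = I.C k} P y∈)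

  -- The words of the boundary are shorter than `l`, hence killed by `π`; by `πι-∂` this is the
  -- magnitude boundary of `πι v`.
  πι-cycle : ∀ k {l v} → k < l → IsShort (suc l) k v → HasLowBoundary k v →
             Submodule.Member (cycles (EMC G l) k) (⟦ πι l k ⟧ v)
  πι-cycle zero    _   _  _   = tt
  πι-cycle (suc k) k<l v∈ ∂v∈ = ≋-trans (≋-sym (πι-∂ v∈)) (πι-short (short-mono (ℕ.<⇒≤ k<l) ∂v∈))

  module _ (diagonal : RegularlyDiagonal G) where

    -- Off the diagonal the cycle `πι v` bounds some `w`. Lifting `w` by `σ` and subtracting its
    -- boundary cancels the part of `v` of length `l`.
    shorten-once : ∀ {k l v} → k < l → IsShort (suc l) k v → HasLowBoundary k v →
                   ∃[ u ] IsShort l k (v ⊕ (- I.∂ k u))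
    shorten-once {k} {l} {v} k<l v∈ ∂v∈
      -- Being zero in the quotient means that the difference from 0 is a boundary, so `∂w≈`
      -- concerns `πι v` minus 0.
      with (w , ∂w≈) ← diagonal k l (ℕ.<⇒≢ k<l) (⟦ πι l k ⟧ v , πι-cycle k k<l v∈ ∂v∈)
      = u , short-πι (-‿∈ (Short _ k) v∈ (∂-short (σ-short w))) (≋-trans
          (-‿homo {M = I.C k} {N = EMC.C l k} (πι l k) v (I.∂ k u))
          (x≈y⇒x-y≈0 {M = EMC.C l k} (≋-sym π∂u≈πv)))
      where
      u : LeftModule.Carrierᴹ (I.C (suc k))
      u = ⟦ σ l (suc k) ⟧ w

      π∂u≈πv : _≈E_ l (⟦ πι l k ⟧ (I.∂ k u)) (⟦ πι l k ⟧ v)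
      π∂u≈πv = ≋-trans (πι-∂ (σ-short w)) (≋-trans (⟦⟧-cong (EMC.d l k) (πι-σ l (suc k) w))
        (≋-trans ∂w≈ (x-0≈x {M = EMC.C l k} _ ≋-refl)))

    -- Here `n` counts the lengths still to be removed above `k`. The descent halts at length `k`,
    -- on the diagonal, where the hypothesis gives no vanishing. Subtracting boundaries keeps the
    -- boundary low.
    shorten-from : ∀ {k} n {v} → IsShort (n + suc k) k v → HasLowBoundary k v →
                   ∃[ u ] IsShort (suc k) k (v ⊕ (- I.∂ k u))
    shorten-from {k} zero    {v} v∈ ∂v∈ =
      𝟎 , Short.resp (≋-sym (x-0≈x {M = I.C k} v (0ᴹ-homo (I.d k)))) v∈
    shorten-from {k} (suc n) {v} v∈ ∂v∈ =
      let (u₁ , v₁∈) = shorten-once (ℕ.m≤n+m (suc k) n) v∈ ∂v∈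
          (u₂ , v₂∈) = shorten-from n v₁∈ (-‿∈ (LowBoundary k) ∂v∈ (lowBoundary-∂ k u₁))
      in u₁ ⊕ u₂ , Short.resp (regroup u₁ u₂) v₂∈
      where
      open LeftModule (I.C k)
      open AbelianGroupProperties +ᴹ-abelianGroup using (⁻¹-∙-comm)
      regroup : ∀ u₁ u₂ → (v ⊕ (- I.∂ k u₁)) ⊕ (- I.∂ k u₂) ≈I v ⊕ (- I.∂ k (u₁ ⊕ u₂))
      regroup u₁ u₂ = ≋-trans (+ᴹ-assoc _ _ _)
        (+ᴹ-congˡ (≋-trans (⁻¹-∙-comm _ _) (-ᴹ‿cong (≋-sym (+ᴹ-homo (I.d k) u₁ u₂)))))

    shorten : ∀ k v → HasLowBoundary k v → ∃[ u ] IsShort (suc k) k (v ⊕ (- I.∂ k u))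
    shorten k v = let (n , v∈) = every-short v in shorten-from n (short-mono (ℕ.m≤m+n n (suc k)) v∈)

  -- Regular path chains as short chains of injective words.

  -- Sends a tuple that is not both strongly regular and allowed to 0, hence a chain map only on Ω.
  ρ : ∀ k → LinearMap (Λ.C k) (I.C k)
  ρ k = compose {M = Λ.C k} {N = EMC.C k k} {P = I.C k} (π k k) (σ k k)

  ρ-short : ∀ {k} v → IsShort (suc k) k (⟦ ρ k ⟧ v)
  ρ-short {k} v = σ-short (⟦ π k k ⟧ v)

  ρ-gen : ∀ {k} {x : Word k} → Length G (proj₁ x) k → ⟦ ρ k ⟧ (gen (proj₁ x , tt)) ≈I gen x
  ρ-gen {k} {_ , u , _} ds = ≋-trans (⟦⟧-cong (σ k k) (π-gen k u (yes ds))) (FreeModule.gen-cong refl)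

  -- Together with `ι-ρ`, this identifies the chains of minimal length in degree `k` with the
  -- allowed ones.
  ρ-ι : ∀ {k v} → IsShort (suc k) k v → ⟦ ρ k ⟧ (⟦ ι k ⟧ v) ≈I v
  ρ-ι {k} = span-≈ {M = I.C k} {N = I.C k}
    (compose {M = I.C k} {N = Λ.C k} {P = I.C k} (ι k) (ρ k)) (identityMap (I.C k))
    (λ { (x@(_ , u , _) , l , l<1+k , ds) →
         ρ-gen (Length-minimal G u l<1+k ds) })

  IsAllowed : ∀ k → LeftModule.Carrierᴹ (Λ.C k) → Set _
  IsAllowed k = Submodule.Member (Aι G k)

  ι-ρ : ∀ {k v} → IsAllowed k v → ⟦ ι k ⟧ (⟦ ρ k ⟧ v) ≈Λ v
  ι-ρ {k} = span-≈ {M = Λ.C k} {N = Λ.C k}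
    (compose {M = Λ.C k} {N = I.C k} {P = Λ.C k} (ρ k) (ι k)) (identityMap (Λ.C k))
    (λ { (x , u , a) → let ds = Allowed⇒Length G u a in
         ⟦⟧-cong (ι k) (ρ-gen {x = x , u , Length⇒AllPairs G ds} ds) })

  ι-allowed : ∀ {k v} → IsShort (suc k) k v → IsAllowed k (⟦ ι k ⟧ v)
  ι-allowed {k} = span-⊆ {M = I.C k} (preimage {M = I.C k} {N = Λ.C k} (ι k) (Aι G k))
    (λ { ((x , u , _) , l , l<1+k , ds) →
         gen-∈ (x , u , Length⇒Allowed G u (Length-minimal G u l<1+k ds)) })

  module Ω = ChainComplex (Ωι G)

  ι-Ω : ∀ k {v} → IsShort (suc k) k v → HasLowBoundary k v →
        Submodule.Member (Ωι-submodule G k) (⟦ ι k ⟧ v)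
  ι-Ω zero    v∈ _       = ι-allowed v∈
  ι-Ω (suc k) {v} v∈ ∂v∈ = ι-allowed v∈ , resp-∈ (ι-∂ k v) (ι-allowed ∂v∈)

  Ω-allowed : ∀ k {v} → Submodule.Member (Ωι-submodule G k) v → IsAllowed k v
  Ω-allowed zero    v∈       = v∈
  Ω-allowed (suc k) (v∈ , _) = v∈

  -- After applying the injective `ι`, both sides become the boundary of `v`, because `ι-ρ` applies
  -- to `v` and to its boundary, both allowed for an element of Ω.
  ρ-∂ : ∀ k (v : LeftModule.Carrierᴹ (Ω.C (suc k))) →
        ⟦ ρ k ⟧ (Λ.∂ k (proj₁ v)) ≈I I.∂ k (⟦ ρ (suc k) ⟧ (proj₁ v))
  ρ-∂ k (v , v∈ , ∂v∈) = ι-injective (≋-trans (ι-ρ ∂v∈)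
    (≋-sym (≋-trans (ι-∂ k (⟦ ρ (suc k) ⟧ v)) (⟦⟧-cong (Λ.d k) (ι-ρ v∈)))))

  -- The inclusion of Ω into the chains of `Inj`; it passes through `ρ` because Ω is given as a
  -- submodule of `Λ`.
  φ : ∀ k → LinearMap (Ω.C k) (I.C k)
  φ k = compose {M = Ω.C k} {N = Λ.C k} {P = I.C k} (inclusion {M = Λ.C k} (Ωι-submodule G k)) (ρ k)

  φ-reflects-0 : ∀ k z → ⟦ φ k ⟧ z ≈I 𝟎 → proj₁ z ≈Λ 𝟎
  φ-reflects-0 k z φz≈0 = ≋-trans (≋-sym (ι-ρ (Ω-allowed k (proj₂ z)))) (⟦⟧-cong (ι k) φz≈0)

  -- Injectivity and surjectivity on homology.

  module _ (diagonal : RegularlyDiagonal G) (k : ℕ) where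

    -- The boundary of `u` is short, so `u` can be shortened by subtracting a boundary. This leaves
    -- its own boundary unchanged and moves it into the image of Ω.
    φ-reflects-∂ : ∀ z u → I.∂ k u ≈I ⟦ φ k ⟧ z →
                   Σ[ w ∈ LeftModule.Carrierᴹ (Ω.C (suc k)) ] Λ.∂ k (proj₁ w) ≈Λ proj₁ z
    φ-reflects-∂ z u ∂u≈ρz =
      let (u′ , u-∂u′∈) = shorten diagonal (suc k) u (Short.resp (≋-sym ∂u≈ρz) (ρ-short (proj₁ z)))
          ∂u-∂u′≈ρz     = ≋-trans (-‿homo {M = I.C (suc k)} {N = I.C k} (I.d k) u (I.∂ (suc k) u′))
                            (≋-trans (x-0≈x {M = I.C k} _ (I.∂∂≈0 k u′)) ∂u≈ρz)
          ∂u-∂u′∈       = Short.resp (≋-sym ∂u-∂u′≈ρz) (ρ-short (proj₁ z))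
      in (_ , ι-Ω (suc k) u-∂u′∈ ∂u-∂u′∈) ,
         ≋-trans (≋-sym (ι-∂ k (u ⊕ (- I.∂ (suc k) u′))))
           (≋-trans (⟦⟧-cong (ι k) ∂u-∂u′≈ρz) (ι-ρ (Ω-allowed k (proj₂ z))))

    φ-surjective : ∀ v → HasLowBoundary k v → ∃[ z ] ∃[ u ] I.∂ k u ≈I ⟦ φ k ⟧ z ⊕ (- v)
    φ-surjective v ∂v∈ =
      let (u , v′∈) = shorten diagonal k v ∂v∈
          ∂v′∈      = -‿∈ (LowBoundary k) ∂v∈ (lowBoundary-∂ k u)
      in (⟦ ι k ⟧ (v ⊕ (- I.∂ k u)) , ι-Ω k v′∈ ∂v′∈) ,
         -- The shortened chain is `v` minus the boundary of `u`; taking `v` away again leaves the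
         -- boundary of `- u`.
         (- u) , ≋-trans (-ᴹ-homo (I.d k) u)
           (≋-sym (≋-trans (+ᴹ-congʳ (ρ-ι v′∈)) (xyx⁻¹≈y v (- I.∂ k u))))
      where
      open LeftModule (I.C k)
      open AbelianGroupProperties +ᴹ-abelianGroup using (xyx⁻¹≈y)

  φ-surjective₀ : RegularlyDiagonal G → ∀ v → ∃[ z ] ∃[ u ] I.∂ 0 u ≈I ⟦ φ 0 ⟧ z ⊕ (- v)
  φ-surjective₀ diagonal v = φ-surjective diagonal 0 v tt

  φ-surjective₊ : RegularlyDiagonal G → ∀ k v → I.∂ k v ≈I 𝟎 →
                  ∃[ z ] ∃[ u ] I.∂ (suc k) u ≈I ⟦ φ (suc k) ⟧ z ⊕ (- v)
  φ-surjective₊ diagonal k v ∂v≈0 =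
    φ-surjective diagonal (suc k) v (Short.resp (≋-sym ∂v≈0) Short.0∈)

proposition5p17 : {c ℓ : Level} (R : CommutativeRing c ℓ) (G : FiniteDigraph) →
    let open OverRing R in
    Connected G → RegularlyDiagonal G →
    (k : ℕ) → H (Ωι G) k ≅ H (chains (Inj G)) k
proposition5p17 R G _ diagonal =
  homology-≅ _ _ φ ρ-∂ (φ-reflects-∂ diagonal) φ-reflects-0
    (φ-surjective₀ diagonal) (φ-surjective₊ diagonal)
  where
  open LinearAlgebra R
  open Comparison R G
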